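{- Let $k\ge 2$, let $p_1<p_2<\cdots<p_k$ be odd primes, and let $n=2p_1p_2\cdots p_k$. Then $\min\{\deg f(x): f(x)\in\mathcal{A}_n\}\le n-v$, where $$v=\begin{cases}\frac{n}{2}\cdot\frac{p_1+p_2}{p_1p_2}, & \text{if } 2p_1>p_2,\\ \frac{3n}{2p_2}, & \text{if } 2p_1<p_2<3p_1,\\ \frac{n}{2p_1}, & \text{if } 3p_1<p_2.\end{cases}$$
   Context: For a positive integer $n$, $\Phi_n(x)$ denotes the $n$-th cyclotomic polynomial and $\mathcal{A}_n$ is the set of polynomials $f(x)\in\mathbb{Z}[x]$ such that $\Phi_n(x)$ divides $f(x)$ and $f(x)=x^m-a_{m-1}x^{m-1}-\cdots-a_1x-1$ for some integer $m<n$ with $a_i\in\{0,1\}$ for $1\le i<m$. -}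

module Defs where

open import Data.Nat as ℕ using (ℕ; zero; suc; _∸_)
open import Data.Nat.Divisibility using (_∣?_)
open import Data.Integer as ℤ using (ℤ; +_; -[1+_])
open import Data.List using (List; []; _∷_; _++_; map; foldr; filter; reverse; replicate; length; upTo)
open import Data.Bool using (Bool; true; false; if_then_else_)
open import Data.Product using (Σ; ∃; _×_; _,_)
open import Relation.Binary.PropositionalEquality using (_≡_)

-- Polynomials over ℤ as coefficient lists, lowest degree first:
-- [c₀, c₁, …, c_d] represents c₀ + c₁ x + … + c_d x^d.

Poly : Set
Poly = List ℤ

_+ₚ_ : Poly → Poly → Poly
[] +ₚ q = q
(a ∷ p) +ₚ [] = a ∷ p
(a ∷ p) +ₚ (b ∷ q) = (a ℤ.+ b) ∷ (p +ₚ q)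

scaleₚ : ℤ → Poly → Poly
scaleₚ c = map (c ℤ.*_)

_*ₚ_ : Poly → Poly → Poly
[] *ₚ q = []
(a ∷ p) *ₚ q = scaleₚ a q +ₚ (+ 0 ∷ (p *ₚ q))

coeff : Poly → ℕ → ℤ
coeff [] i = + 0
coeff (a ∷ p) zero = a
coeff (a ∷ p) (suc i) = coeff p i

_≈ₚ_ : Poly → Poly → Set
p ≈ₚ q = ∀ i → coeff p i ≡ coeff q i

_∣ₚ_ : Poly → Poly → Set
d ∣ₚ f = ∃ λ g → (d *ₚ g) ≈ₚ f

-- Exact division by a monic polynomial (long division), used only to
-- compute cyclotomic polynomials.  Internally lists are highest-first.

private
  subMul : ℤ → List ℤ → List ℤ → List ℤ
  subMul c [] p = p
  subMul c (x ∷ d) [] = []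
  subMul c (x ∷ d) (y ∷ p) = (y ℤ.- c ℤ.* x) ∷ subMul c d p

  divStep : ℕ → List ℤ → List ℤ → List ℤ
  divStep zero p d = []
  divStep (suc k) [] d = []
  divStep (suc k) (c ∷ p) [] = []
  divStep (suc k) (c ∷ p) (one ∷ d) = c ∷ divStep k (subMul c d p) (one ∷ d)

-- quotient of p by the monic polynomial d (both lowest-first, d with
-- leading coefficient 1 as last entry)
divMonic : Poly → Poly → Poly
divMonic p d = reverse (divStep (suc (length p ∸ length d)) (reverse p) (reverse d))

xⁿ-1 : ℕ → Poly
xⁿ-1 zero = []
xⁿ-1 (suc n) = -[1+ 0 ] ∷ (replicate n (+ 0) ++ (+ 1 ∷ []))

properDivisors : ℕ → List ℕ
properDivisors n = filter (_∣? n) (map suc (upTo (n ∸ 1)))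

prodₚ : List Poly → Poly
prodₚ = foldr _*ₚ_ (+ 1 ∷ [])

cycAux : ℕ → ℕ → Poly
cycAux zero n = + 1 ∷ []
cycAux (suc k) n = divMonic (xⁿ-1 n) (prodₚ (map (cycAux k) (properDivisors n)))

-- the n-th cyclotomic polynomial (n ≥ 1)
Φ : ℕ → Poly
Φ n = cycAux n n

-- The polynomial x^m - a_{m-1} x^{m-1} - … - a_1 x - 1 where the list
-- as = [a_1, …, a_{m-1}] of 0/1 digits (as Bools) has length m - 1.

bit : Bool → ℤ
bit b = if b then + 1 else + 0

polyA : List Bool → Poly
polyA as = -[1+ 0 ] ∷ (map (λ b → ℤ.- bit b) as ++ (+ 1 ∷ []))

degA : List Bool → ℕ
degA as = suc (length as)

InA : ℕ → List Bool → Set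
InA n as = (degA as ℕ.< n) × (Φ n ∣ₚ polyA as)

-- Let p < q be the two smallest primes, n = 2pqw, y = xʷ. Modulo Φₙ we have
-- y^{pq} = -1, and the powers of y along a full progression of step 2q (p terms)
-- or of step 2p (q terms) sum to 0. Hence deleting y^c from an expression that sums to 0
-- leaves an expression for -y^c = y^{c+pq}, and c is taken so that c + pq = deg f:
--   q < 2p:  {2qi : i < p} and {2pj - q : 1 ≤ j < q} sum to 0 once pq - q is deleted;
--            deleting c = pq - p - q as well gives degree 2pq - p - q;
--   2p < q:  {2pj : j < q - 1} and {q(2i+1) - 2p : i < p} sum to 0 once pq - 2p is deleted;
--            deleting c = pq - 3p as well gives degree 2pq - 3p;
--   always:  with y = x^{qw} and y^p = -1, {2i : i < p} without c = p - 1 gives degree 2p - 1.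
-- The exponents are distinct by parity.
--
-- That Φₙ, computed by long division, satisfies Φₙ · ∏_{d ∣ n, d < n} Φ_d = xⁿ - 1 is proved by
-- induction: for d ≠ e with g = gcd(d, e) < e, the ideal (Φ_d, Φ_e) contains xᵍ - 1 and
-- (xᵉ - 1)/(xᵍ - 1) ≡ e/g, a nonzero constant, and a monic polynomial dividing a nonzero
-- constant multiple of a polynomial divides the polynomial.

module Submission where

open import Defs
open import Data.Nat using (ℕ; _+_; _*_; _%_; _<_; _≤_)
open import Data.Nat.Primality using (Prime)
open import Data.List using (List; _∷_)
open import Data.Nat.ListAction using (product)
open import Data.List.Relation.Unary.All using (All)
open import Data.List.Relation.Unary.Linked using (Linked)
open import Data.Product using (∃; _×_)
open import Relation.Binary.PropositionalEquality using (_≡_)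

open import Algebra.Bundles using (CommutativeRing; AbelianGroup)
import Algebra.Solver.Ring
open import Algebra.Solver.Ring.AlmostCommutativeRing using (fromCommutativeRing; _-Raw-AlmostCommutative⟶_)
open import Algebra.Structures using (IsCommutativeRing)
open import Data.Bool using (Bool; true; false; if_then_else_; T)
open import Data.Bool.ListAction using (any)
open import Data.Empty using (⊥-elim)
open import Data.Integer as ℤ using (ℤ; +_; -[1+_])
import Data.Integer.Properties as ℤ
open import Data.List using ([]; _++_; _∷ʳ_; map; filter; replicate; reverse; length; upTo; applyUpTo)
open import Data.List.Membership.Propositional using (_∈_; _∉_)
open import Data.List.Membership.Propositional.Properties using (∈-filter⁺; ∈-map⁺; ∈-applyUpTo⁺; ∈-applyUpTo⁻; ∈-++⁺ˡ; ∈-++⁺ʳ)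
import Data.List.Properties as List
open import Data.List.Relation.Binary.Disjoint.Propositional using (Disjoint)
open import Data.List.Relation.Unary.All as All using ([]; _∷_)
import Data.List.Relation.Unary.All.Properties as All
open import Data.List.Relation.Unary.AllPairs using ([]; _∷_)
open import Data.List.Relation.Unary.Any using (here; there)
import Data.List.Relation.Unary.Linked as Linked
open import Data.List.Relation.Unary.Unique.Propositional using (Unique)
import Data.List.Relation.Unary.Unique.Propositional.Properties as Unique
import Data.Maybe as Maybe
open import Data.Nat as ℕ using (zero; suc; _∸_; s≤s; z≤n)
open import Data.Nat.DivMod using (m≡m%n+[m/n]*n)
open import Data.Nat.Divisibility using (_∣?_; divides; ∣⇒≤; ∣-refl; ∣-trans) renaming (_∣_ to _∣ₙ_)
open import Data.Nat.GCD using (gcd; gcd-GCD; gcd[m,n]∣m; gcd[m,n]∣n; gcd[m,n]≢0; module Bézout)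
open import Data.Nat.Induction using (<-rec)
open import Data.Nat.ListAction.Properties using (product≢0)
open import Data.Nat.Primality using (¬prime[1]; prime⇒nonZero)
import Data.Nat.Properties as ℕ
open import Data.Nat.Tactic.RingSolver using (solve-∀)
open import Data.Product using (∃₂; _,_; proj₁; proj₂)
open import Data.Sum using (inj₁; inj₂; [_,_]′)
open import Data.Unit using (tt)
open import Level using (0ℓ)
open import Relation.Binary.Bundles using (Setoid)
open import Relation.Binary.PropositionalEquality as ≡ using (_≢_)
open import Relation.Nullary using (¬_; does; yes; no)
open import Relation.Nullary.Decidable using (dec⇒maybe; dec-true; dec-false; ¬?)
open import Relation.Unary using (Decidable)

-- divStep and subMul are private in Defs: the metas are solved by their only possible values,
-- Defs.divStep and Defs.subMul.
mutual
  divStep : ℕ → List ℤ → List ℤ → List ℤ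
  divStep = _

  divMonic≡ : ∀ p d → divMonic p d ≡ reverse (divStep (suc (length p ∸ length d)) (reverse p) (reverse d))
  -- With `reverse` and the three arguments abstracted to variables, the equation is a pattern that
  -- determines the meta.
  divMonic≡ p d with reverse {A = ℤ}
  ... | r with suc (length p ∸ length d) | r p | r d
  ... | k | p′ | d′ = ≡.refl

mutual
  subMul : ℤ → List ℤ → List ℤ → List ℤ
  subMul = _

  divStep-suc : ∀ k c p u d → divStep (suc k) (c ∷ p) (u ∷ d) ≡ c ∷ divStep k (subMul c d p) (u ∷ d)
  divStep-suc k c p u d = ≡.refl

-- The ring ℤ[X]

-ₚ_ : Poly → Poly
-ₚ_ = map (λ a → ℤ.- a)

coeff-+ : ∀ p q i → coeff (p +ₚ q) i ≡ coeff p i ℤ.+ coeff q i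
coeff-+ [] q i = ≡.sym (ℤ.+-identityˡ _)
coeff-+ (a ∷ p) [] i = ≡.sym (ℤ.+-identityʳ _)
coeff-+ (a ∷ p) (b ∷ q) zero = ≡.refl
coeff-+ (a ∷ p) (b ∷ q) (suc i) = coeff-+ p q i

coeff-scale : ∀ c p i → coeff (scaleₚ c p) i ≡ c ℤ.* coeff p i
coeff-scale c [] i = ≡.sym (ℤ.*-zeroʳ c)
coeff-scale c (a ∷ p) zero = ≡.refl
coeff-scale c (a ∷ p) (suc i) = coeff-scale c p i

coeff-neg : ∀ p i → coeff (-ₚ p) i ≡ ℤ.- coeff p i
coeff-neg [] i = ≡.refl
coeff-neg (a ∷ p) zero = ≡.refl
coeff-neg (a ∷ p) (suc i) = coeff-neg p i

-- A record, so that the two polynomials can be inferred from an equality proof.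
infix 4 _≋_
record _≋_ (p q : Poly) : Set where
  constructor coeffwise
  field coeff-≡ : p ≈ₚ q
open _≋_

polySetoid : Setoid 0ℓ 0ℓ
polySetoid = record
  { Carrier = Poly
  ; _≈_ = _≋_
  ; isEquivalence = record
    { refl = coeffwise λ _ → ≡.refl
    ; sym = λ e → coeffwise λ i → ≡.sym (coeff-≡ e i)
    ; trans = λ e f → coeffwise λ i → ≡.trans (coeff-≡ e i) (coeff-≡ f i)
    }
  }

+ₚ-cong : ∀ {p p′ q q′} → p ≋ p′ → q ≋ q′ → (p +ₚ q) ≋ (p′ +ₚ q′)
+ₚ-cong {p} {p′} {q} {q′} e f = coeffwise λ i → begin
  coeff (p +ₚ q) i              ≡⟨ coeff-+ p q i ⟩
  coeff p i ℤ.+ coeff q i       ≡⟨ ≡.cong₂ ℤ._+_ (coeff-≡ e i) (coeff-≡ f i) ⟩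
  coeff p′ i ℤ.+ coeff q′ i     ≡⟨ coeff-+ p′ q′ i ⟨
  coeff (p′ +ₚ q′) i            ∎
  where open ≡.≡-Reasoning

+ₚ-0-abelianGroup : AbelianGroup 0ℓ 0ℓ
+ₚ-0-abelianGroup = record
  { Carrier = Poly ; _≈_ = _≋_ ; _∙_ = _+ₚ_ ; ε = [] ; _⁻¹ = -ₚ_
  ; isAbelianGroup = record
    { isGroup = record
      { isMonoid = record
        { isSemigroup = record
          { isMagma = record
            { isEquivalence = Setoid.isEquivalence polySetoid
            ; ∙-cong = +ₚ-cong
            }
          ; assoc = assoc
          }
        ; identity = (λ _ → coeffwise λ _ → ≡.refl) , λ p → coeffwise λ i → ≡.trans (coeff-+ p [] i) (ℤ.+-identityʳ _)
        }
      ; inverse = inverseˡ , λ p → Setoid.trans polySetoid (comm p (-ₚ p)) (inverseˡ p)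
      ; ⁻¹-cong = λ {p} {q} e → coeffwise λ i →
          ≡.trans (coeff-neg p i) (≡.trans (≡.cong (λ a → ℤ.- a) (coeff-≡ e i)) (≡.sym (coeff-neg q i)))
      }
    ; comm = comm
    }
  }
  where
  assoc : ∀ p q r → ((p +ₚ q) +ₚ r) ≋ (p +ₚ (q +ₚ r))
  assoc p q r = coeffwise λ i → begin
    coeff ((p +ₚ q) +ₚ r) i                     ≡⟨ coeff-+ (p +ₚ q) r i ⟩
    coeff (p +ₚ q) i ℤ.+ coeff r i              ≡⟨ ≡.cong (ℤ._+ coeff r i) (coeff-+ p q i) ⟩
    (coeff p i ℤ.+ coeff q i) ℤ.+ coeff r i     ≡⟨ ℤ.+-assoc (coeff p i) _ _ ⟩
    coeff p i ℤ.+ (coeff q i ℤ.+ coeff r i)     ≡⟨ ≡.cong (ℤ._+_ (coeff p i)) (coeff-+ q r i) ⟨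
    coeff p i ℤ.+ coeff (q +ₚ r) i              ≡⟨ coeff-+ p (q +ₚ r) i ⟨
    coeff (p +ₚ (q +ₚ r)) i                     ∎
    where open ≡.≡-Reasoning
  comm : ∀ p q → (p +ₚ q) ≋ (q +ₚ p)
  comm p q = coeffwise λ i → ≡.trans (coeff-+ p q i) (≡.trans (ℤ.+-comm (coeff p i) _) (≡.sym (coeff-+ q p i)))
  inverseˡ : ∀ p → ((-ₚ p) +ₚ p) ≋ []
  inverseˡ p = coeffwise λ i → ≡.trans (coeff-+ (-ₚ p) p i)
    (≡.trans (≡.cong (ℤ._+ coeff p i) (coeff-neg p i)) (ℤ.+-inverseˡ (coeff p i)))

module +ₚ where
  open AbelianGroup +ₚ-0-abelianGroup public
  open import Algebra.Properties.CommutativeSemigroup commutativeSemigroup public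

module ≋-Reasoning where
  open import Relation.Binary.Reasoning.Setoid polySetoid public

∷-cong : ∀ {a b p q} → a ≡ b → p ≋ q → (a ∷ p) ≋ (b ∷ q)
∷-cong e f = coeffwise λ { zero → e ; (suc i) → coeff-≡ f i }

0∷[]≋[] : (+ 0 ∷ []) ≋ []
0∷[]≋[] = coeffwise λ { zero → ≡.refl ; (suc i) → ≡.refl }

scale-cong : ∀ c {p q} → p ≋ q → scaleₚ c p ≋ scaleₚ c q
scale-cong c {p} {q} e = coeffwise λ i →
  ≡.trans (coeff-scale c p i) (≡.trans (≡.cong (c ℤ.*_) (coeff-≡ e i)) (≡.sym (coeff-scale c q i)))

scale-distribˡ-+ : ∀ c p q → scaleₚ c (p +ₚ q) ≋ (scaleₚ c p +ₚ scaleₚ c q)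
scale-distribˡ-+ c [] q = +ₚ.refl
scale-distribˡ-+ c (a ∷ p) [] = +ₚ.refl
scale-distribˡ-+ c (a ∷ p) (b ∷ q) = ∷-cong (ℤ.*-distribˡ-+ c a b) (scale-distribˡ-+ c p q)

scale-distribʳ-+ : ∀ a b p → scaleₚ (a ℤ.+ b) p ≋ (scaleₚ a p +ₚ scaleₚ b p)
scale-distribʳ-+ a b [] = +ₚ.refl
scale-distribʳ-+ a b (c ∷ p) = ∷-cong (ℤ.*-distribʳ-+ c a b) (scale-distribʳ-+ a b p)

scale-scale : ∀ a b p → scaleₚ a (scaleₚ b p) ≋ scaleₚ (a ℤ.* b) p
scale-scale a b [] = +ₚ.refl
scale-scale a b (c ∷ p) = ∷-cong (≡.sym (ℤ.*-assoc a b c)) (scale-scale a b p)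

scale-1 : ∀ p → scaleₚ (+ 1) p ≋ p
scale-1 [] = +ₚ.refl
scale-1 (a ∷ p) = ∷-cong (ℤ.*-identityˡ a) (scale-1 p)

*ₚ-zeroʳ : ∀ p → (p *ₚ []) ≋ []
*ₚ-zeroʳ [] = +ₚ.refl
*ₚ-zeroʳ (a ∷ p) = coeffwise λ { zero → ≡.refl ; (suc i) → coeff-≡ (*ₚ-zeroʳ p) i }

*ₚ-∷ : ∀ p b q → (p *ₚ (b ∷ q)) ≋ (scaleₚ b p +ₚ (+ 0 ∷ (p *ₚ q)))
*ₚ-∷ [] b q = +ₚ.sym 0∷[]≋[]
*ₚ-∷ (a ∷ p) b q = ∷-cong (≡.cong (ℤ._+ + 0) (ℤ.*-comm a b)) (begin
  scaleₚ a q +ₚ (p *ₚ (b ∷ q))                        ≈⟨ +ₚ.∙-congˡ (*ₚ-∷ p b q) ⟩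
  scaleₚ a q +ₚ (scaleₚ b p +ₚ (+ 0 ∷ (p *ₚ q)))      ≈⟨ +ₚ.x∙yz≈y∙xz (scaleₚ a q) (scaleₚ b p) _ ⟩
  scaleₚ b p +ₚ (scaleₚ a q +ₚ (+ 0 ∷ (p *ₚ q)))      ∎)
  where open ≋-Reasoning

*ₚ-comm : ∀ p q → (p *ₚ q) ≋ (q *ₚ p)
*ₚ-comm [] q = +ₚ.sym (*ₚ-zeroʳ q)
*ₚ-comm (a ∷ p) q = begin
  scaleₚ a q +ₚ (+ 0 ∷ (p *ₚ q))  ≈⟨ +ₚ.∙-congˡ (∷-cong ≡.refl (*ₚ-comm p q)) ⟩
  scaleₚ a q +ₚ (+ 0 ∷ (q *ₚ p))  ≈⟨ *ₚ-∷ q a p ⟨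
  q *ₚ (a ∷ p)                    ∎
  where open ≋-Reasoning

*ₚ-congˡ : ∀ p {q q′} → q ≋ q′ → (p *ₚ q) ≋ (p *ₚ q′)
*ₚ-congˡ [] e = +ₚ.refl
*ₚ-congˡ (a ∷ p) e = +ₚ-cong (scale-cong a e) (∷-cong ≡.refl (*ₚ-congˡ p e))

*ₚ-cong : ∀ {p p′ q q′} → p ≋ p′ → q ≋ q′ → (p *ₚ q) ≋ (p′ *ₚ q′)
*ₚ-cong {p} {p′} {q} {q′} e f = begin
  p *ₚ q     ≈⟨ *ₚ-congˡ p f ⟩
  p *ₚ q′    ≈⟨ *ₚ-comm p q′ ⟩
  q′ *ₚ p    ≈⟨ *ₚ-congˡ q′ e ⟩
  q′ *ₚ p′   ≈⟨ *ₚ-comm q′ p′ ⟩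
  p′ *ₚ q′   ∎
  where open ≋-Reasoning

*ₚ-distribʳ-+ : ∀ r p q → ((p +ₚ q) *ₚ r) ≋ ((p *ₚ r) +ₚ (q *ₚ r))
*ₚ-distribʳ-+ r [] q = +ₚ.refl
*ₚ-distribʳ-+ r (a ∷ p) [] = +ₚ.sym (+ₚ.identityʳ ((a ∷ p) *ₚ r))
*ₚ-distribʳ-+ r (a ∷ p) (b ∷ q) = begin
  scaleₚ (a ℤ.+ b) r +ₚ (+ 0 ∷ ((p +ₚ q) *ₚ r))
    ≈⟨ +ₚ-cong (scale-distribʳ-+ a b r) (∷-cong ≡.refl (*ₚ-distribʳ-+ r p q)) ⟩
  (scaleₚ a r +ₚ scaleₚ b r) +ₚ ((+ 0 ∷ (p *ₚ r)) +ₚ (+ 0 ∷ (q *ₚ r)))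
    ≈⟨ +ₚ.interchange (scaleₚ a r) (scaleₚ b r) (+ 0 ∷ (p *ₚ r)) (+ 0 ∷ (q *ₚ r)) ⟩
  (scaleₚ a r +ₚ (+ 0 ∷ (p *ₚ r))) +ₚ (scaleₚ b r +ₚ (+ 0 ∷ (q *ₚ r)))
    ∎
  where open ≋-Reasoning

0∷-*ₚ : ∀ p q → ((+ 0 ∷ p) *ₚ q) ≋ (+ 0 ∷ (p *ₚ q))
0∷-*ₚ p q = coeffwise λ i → ≡.trans (coeff-+ (scaleₚ (+ 0) q) (+ 0 ∷ (p *ₚ q)) i)
  (≡.trans (≡.cong (ℤ._+ coeff (+ 0 ∷ (p *ₚ q)) i) (coeff-scale (+ 0) q i)) (ℤ.+-identityˡ _))

scale-*ₚ : ∀ a p q → (scaleₚ a p *ₚ q) ≋ scaleₚ a (p *ₚ q)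
scale-*ₚ a [] q = +ₚ.refl
scale-*ₚ a (b ∷ p) q = begin
  scaleₚ (a ℤ.* b) q +ₚ (+ 0 ∷ (scaleₚ a p *ₚ q))
    ≈⟨ +ₚ-cong (+ₚ.sym (scale-scale a b q)) (∷-cong (≡.sym (ℤ.*-zeroʳ a)) (scale-*ₚ a p q)) ⟩
  scaleₚ a (scaleₚ b q) +ₚ scaleₚ a (+ 0 ∷ (p *ₚ q))
    ≈⟨ scale-distribˡ-+ a (scaleₚ b q) (+ 0 ∷ (p *ₚ q)) ⟨
  scaleₚ a (scaleₚ b q +ₚ (+ 0 ∷ (p *ₚ q)))
    ∎
  where open ≋-Reasoning

*ₚ-assoc : ∀ p q r → ((p *ₚ q) *ₚ r) ≋ (p *ₚ (q *ₚ r))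
*ₚ-assoc [] q r = +ₚ.refl
*ₚ-assoc (a ∷ p) q r = begin
  (scaleₚ a q +ₚ (+ 0 ∷ (p *ₚ q))) *ₚ r
    ≈⟨ *ₚ-distribʳ-+ r (scaleₚ a q) (+ 0 ∷ (p *ₚ q)) ⟩
  (scaleₚ a q *ₚ r) +ₚ ((+ 0 ∷ (p *ₚ q)) *ₚ r)
    ≈⟨ +ₚ-cong (scale-*ₚ a q r) (0∷-*ₚ (p *ₚ q) r) ⟩
  scaleₚ a (q *ₚ r) +ₚ (+ 0 ∷ ((p *ₚ q) *ₚ r))
    ≈⟨ +ₚ.∙-congˡ (∷-cong ≡.refl (*ₚ-assoc p q r)) ⟩
  scaleₚ a (q *ₚ r) +ₚ (+ 0 ∷ (p *ₚ (q *ₚ r)))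
    ∎
  where open ≋-Reasoning

*ₚ-identityˡ : ∀ p → ((+ 1 ∷ []) *ₚ p) ≋ p
*ₚ-identityˡ p = begin
  scaleₚ (+ 1) p +ₚ (+ 0 ∷ [])  ≈⟨ +ₚ-cong (scale-1 p) 0∷[]≋[] ⟩
  p +ₚ []                       ≈⟨ +ₚ.identityʳ p ⟩
  p                             ∎
  where open ≋-Reasoning

-- The commutative ring of polynomials and its ring solver

opaque
  infixl 6 _⊕_
  infixl 7 _⊗_
  infix  8 ⊖_

  -- Opaque copies of the operations: unification must not unfold them.
  _⊕_ _⊗_ : Poly → Poly → Poly
  _⊕_ = _+ₚ_
  _⊗_ = _*ₚ_

  ⊖_ : Poly → Poly
  ⊖_ = -ₚ_

  const : ℤ → Poly
  const c = c ∷ []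

  ⊕≡+ₚ : ∀ p q → p ⊕ q ≡ p +ₚ q
  ⊕≡+ₚ _ _ = ≡.refl

  ⊗≡*ₚ : ∀ p q → p ⊗ q ≡ p *ₚ q
  ⊗≡*ₚ _ _ = ≡.refl

  ⊖≡-ₚ : ∀ p → ⊖ p ≡ -ₚ p
  ⊖≡-ₚ _ = ≡.refl

  const≡∷[] : ∀ c → const c ≡ c ∷ []
  const≡∷[] _ = ≡.refl

  poly-isCommutativeRing : IsCommutativeRing _≋_ _⊕_ _⊗_ ⊖_ [] (const (+ 1))
  poly-isCommutativeRing = record
    { isRing = record
      { +-isAbelianGroup = +ₚ.isAbelianGroup
      ; *-cong = *ₚ-cong
      ; *-assoc = *ₚ-assoc
      ; *-identity = *ₚ-identityˡ , λ p → +ₚ.trans (*ₚ-comm p (+ 1 ∷ [])) (*ₚ-identityˡ p)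
      ; distrib = *ₚ-distribˡ-+ , *ₚ-distribʳ-+
      }
    ; *-comm = *ₚ-comm
    }
    where
    open ≋-Reasoning
    *ₚ-distribˡ-+ : ∀ r p q → (r *ₚ (p +ₚ q)) ≋ ((r *ₚ p) +ₚ (r *ₚ q))
    *ₚ-distribˡ-+ r p q = begin
      r *ₚ (p +ₚ q)             ≈⟨ *ₚ-comm r (p +ₚ q) ⟩
      (p +ₚ q) *ₚ r             ≈⟨ *ₚ-distribʳ-+ r p q ⟩
      (p *ₚ r) +ₚ (q *ₚ r)      ≈⟨ +ₚ-cong (*ₚ-comm p r) (*ₚ-comm q r) ⟩
      (r *ₚ p) +ₚ (r *ₚ q)      ∎

polyRing : CommutativeRing 0ℓ 0ℓ
polyRing = record { isCommutativeRing = poly-isCommutativeRing }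

open CommutativeRing polyRing using (1#; refl; sym; trans; reflexive; +-cong; *-cong; -‿cong; +-assoc; +-identityˡ; +-identityʳ; -‿inverseʳ; *-assoc; *-comm; *-identityˡ; *-identityʳ; zeroˡ; zeroʳ)
open import Algebra.Properties.Semiring.Exp (CommutativeRing.semiring polyRing) using (_^_; ^-homo-*; ^-assocʳ)

+ˡ : ∀ {p q r} → q ≋ r → p ⊕ q ≋ p ⊕ r
+ˡ = +-cong refl

+ʳ : ∀ {p q r} → q ≋ r → q ⊕ p ≋ r ⊕ p
+ʳ e = +-cong e refl

*ˡ : ∀ {p q r} → q ≋ r → p ⊗ q ≋ p ⊗ r
*ˡ = *-cong refl

*ʳ : ∀ {p q r} → q ≋ r → q ⊗ p ≋ r ⊗ p
*ʳ e = *-cong e refl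

opaque
  unfolding _⊕_

  X : Poly
  X = + 0 ∷ + 1 ∷ []

  X-* : ∀ p → X ⊗ p ≋ + 0 ∷ p
  X-* p = trans (0∷-*ₚ (+ 1 ∷ []) p) (∷-cong ≡.refl (*-identityˡ p))

  const-* : ∀ c p → const c ⊗ p ≋ scaleₚ c p
  const-* c p = trans (+ˡ {scaleₚ c p} 0∷[]≋[]) (+-identityʳ (scaleₚ c p))

  ∷-decompose : ∀ a p → a ∷ p ≋ const a ⊕ X ⊗ p
  ∷-decompose a p = trans (∷-cong (≡.sym (ℤ.+-identityʳ a)) refl) (+ˡ {const a} (sym (X-* p)))

  const-+ : ∀ a b → const (a ℤ.+ b) ≋ const a ⊕ const b
  const-+ a b = refl

  const-*-const : ∀ a b → const (a ℤ.* b) ≋ const a ⊗ const b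
  const-*-const a b = ∷-cong (≡.sym (ℤ.+-identityʳ _)) refl

  const-neg : ∀ a → const (ℤ.- a) ≋ ⊖ const a
  const-neg a = refl

  const-0 : const (+ 0) ≋ []
  const-0 = 0∷[]≋[]

  const-sub-* : ∀ y c x → const (y ℤ.- c ℤ.* x) ≋ const y ⊕ ⊖ (const c ⊗ const x)
  const-sub-* y c x = ∷-cong (≡.cong (λ a → y ℤ.+ ℤ.- a) (≡.sym (ℤ.+-identityʳ (c ℤ.* x)))) refl

-- Gives the ring solver integer coefficients, read as constant polynomials. The solver's zero is
-- then `const (+ 0)`, which equals `[]` only up to `_≋_`; hence the appeals to `const-0` around
-- solver calls.
const-homo : CommutativeRing.rawRing ℤ.+-*-commutativeRing -Raw-AlmostCommutative⟶ fromCommutativeRing polyRing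
const-homo = record
  { ⟦_⟧ = const
  ; +-homo = const-+
  ; *-homo = const-*-const
  ; -‿homo = const-neg
  ; 0-homo = const-0
  ; 1-homo = refl
  }

module Solver = Algebra.Solver.Ring _ _ const-homo (λ a b → Maybe.map (λ e → reflexive (≡.cong const e)) (dec⇒maybe (a ℤ.≟ b)))
open Solver using (solve; _:+_; _:*_; :-_; con; _:=_)

-- Turns the list operation at the leading end into ring operations, so that long division on
-- reversed lists can be analysed in the ring.
∷ʳ-≋ : ∀ p c → p ∷ʳ c ≋ p ⊕ const c ⊗ X ^ length p
∷ʳ-≋ [] c = begin
  c ∷ []             ≡⟨ const≡∷[] c ⟨
  const c            ≈⟨ *-identityʳ (const c) ⟨
  const c ⊗ 1#       ≈⟨ +-identityˡ _ ⟨
  [] ⊕ const c ⊗ 1#  ∎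
  where open ≋-Reasoning
∷ʳ-≋ (a ∷ p) c = begin
  a ∷ (p ∷ʳ c)                                      ≈⟨ ∷-decompose a (p ∷ʳ c) ⟩
  const a ⊕ X ⊗ (p ∷ʳ c)                            ≈⟨ +ˡ (*ˡ (∷ʳ-≋ p c)) ⟩
  const a ⊕ X ⊗ (p ⊕ const c ⊗ X ^ length p)        ≈⟨ lemma (const a) X p (const c) (X ^ length p) ⟩
  const a ⊕ X ⊗ p ⊕ const c ⊗ (X ⊗ X ^ length p)    ≈⟨ +ʳ (∷-decompose a p) ⟨
  (a ∷ p) ⊕ const c ⊗ (X ⊗ X ^ length p)            ∎
  where
  open ≋-Reasoning
  lemma : ∀ a x p c y → a ⊕ x ⊗ (p ⊕ c ⊗ y) ≋ a ⊕ x ⊗ p ⊕ c ⊗ (x ⊗ y)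
  lemma = solve 5 (λ a x p c y → a :+ x :* (p :+ c :* y) := a :+ x :* p :+ c :* (x :* y)) refl

reverse-∷ : ∀ c p → reverse (c ∷ p) ≋ reverse p ⊕ const c ⊗ X ^ length p
reverse-∷ c p rewrite List.unfold-reverse c p | ≡.sym (List.length-reverse p) = ∷ʳ-≋ (reverse p) c

-- Division with remainder

length-subMul : ∀ c d p → length (subMul c d p) ≡ length p
length-subMul c [] p = ≡.refl
length-subMul c (x ∷ d) [] = ≡.refl
length-subMul c (x ∷ d) (y ∷ p) = ≡.cong suc (length-subMul c d p)

X^-cong-+ : ∀ {l} m n → l ≡ m + n → X ^ l ≋ X ^ m ⊗ X ^ n
X^-cong-+ m n ≡.refl = ^-homo-* X m n

-- Lists run from the highest coefficient down, so `subMul` aligns `d` with the leading end of `p`;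
-- when `p` has k more entries, this alignment is a multiplication by X^k.
reverse-subMul : ∀ c d p k → length p ≡ k + length d →
  reverse (subMul c d p) ≋ reverse p ⊕ ⊖ (const c ⊗ X ^ k ⊗ reverse d)
reverse-subMul c [] p k eq = lemma (reverse p) (const c ⊗ X ^ k)
  where
  lemma : ∀ p x → p ≋ p ⊕ ⊖ (x ⊗ [])
  lemma p x = trans (solve 2 (λ p x → p := p :+ :- (x :* con (+ 0))) refl p x) (+ˡ (-‿cong (*ˡ const-0)))
reverse-subMul c (x ∷ d) [] k eq with () ← ≡.trans eq (ℕ.+-suc k (length d))
reverse-subMul c (x ∷ d) (y ∷ p) k eq = begin
  reverse ((y ℤ.- c ℤ.* x) ∷ subMul c d p)
    ≈⟨ reverse-∷ _ (subMul c d p) ⟩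
  reverse (subMul c d p) ⊕ const (y ℤ.- c ℤ.* x) ⊗ X ^ length (subMul c d p)
    ≡⟨ ≡.cong (λ l → reverse (subMul c d p) ⊕ const (y ℤ.- c ℤ.* x) ⊗ X ^ l) (length-subMul c d p) ⟩
  reverse (subMul c d p) ⊕ const (y ℤ.- c ℤ.* x) ⊗ X ^ length p
    ≈⟨ +-cong (reverse-subMul c d p k eq′) (*ʳ (const-sub-* y c x)) ⟩
  (P ⊕ ⊖ (C ⊗ Xᵏ ⊗ D)) ⊕ (Y ⊕ ⊖ (C ⊗ const x)) ⊗ X ^ length p
    ≈⟨ distribute P C Xᵏ D Y (const x) (X ^ length p) ⟩
  (P ⊕ Y ⊗ X ^ length p) ⊕ ⊖ (C ⊗ Xᵏ ⊗ D) ⊕ ⊖ (C ⊗ const x ⊗ X ^ length p)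
    ≈⟨ +-cong (+ʳ (sym (reverse-∷ y p))) (-‿cong (*ˡ (X^-cong-+ k (length d) eq′))) ⟩
  reverse (y ∷ p) ⊕ ⊖ (C ⊗ Xᵏ ⊗ D) ⊕ ⊖ (C ⊗ const x ⊗ (Xᵏ ⊗ X ^ length d))
    ≈⟨ collect (reverse (y ∷ p)) C Xᵏ D (const x) (X ^ length d) ⟩
  reverse (y ∷ p) ⊕ ⊖ (C ⊗ Xᵏ ⊗ (D ⊕ const x ⊗ X ^ length d))
    ≈⟨ +ˡ (-‿cong (*ˡ (reverse-∷ x d))) ⟨
  reverse (y ∷ p) ⊕ ⊖ (C ⊗ Xᵏ ⊗ reverse (x ∷ d))
    ∎
  where
  open ≋-Reasoning
  P D C Y Xᵏ : Poly
  P = reverse p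
  D = reverse d
  C = const c
  Y = const y
  Xᵏ = X ^ k
  eq′ : length p ≡ k + length d
  eq′ = ℕ.suc-injective (≡.trans eq (ℕ.+-suc k (length d)))
  distribute : ∀ p c xk d y x xl →
    (p ⊕ ⊖ (c ⊗ xk ⊗ d)) ⊕ (y ⊕ ⊖ (c ⊗ x)) ⊗ xl ≋ (p ⊕ y ⊗ xl) ⊕ ⊖ (c ⊗ xk ⊗ d) ⊕ ⊖ (c ⊗ x ⊗ xl)
  distribute = solve 7 (λ p c xk d y x xl → (p :+ :- (c :* xk :* d)) :+ (y :+ :- (c :* x)) :* xl := (p :+ y :* xl) :+ :- (c :* xk :* d) :+ :- (c :* x :* xl)) refl
  collect : ∀ p c xk d x xl →
    p ⊕ ⊖ (c ⊗ xk ⊗ d) ⊕ ⊖ (c ⊗ x ⊗ (xk ⊗ xl)) ≋ p ⊕ ⊖ (c ⊗ xk ⊗ (d ⊕ x ⊗ xl))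
  collect = solve 6 (λ p c xk d x xl → p :+ :- (c :* xk :* d) :+ :- (c :* x :* (xk :* xl)) := p :+ :- (c :* xk :* (d :+ x :* xl))) refl

length-divStep : ∀ k p u d → length p ≡ k + length d → length (divStep k p (u ∷ d)) ≡ k
length-divStep zero p u d eq = ≡.refl
length-divStep (suc k) (c ∷ p) u d eq =
  ≡.cong suc (length-divStep k (subMul c d p) u d (≡.trans (length-subMul c d p) (ℕ.suc-injective eq)))

-- Degree less than k, read off the coefficients because a list may carry leading zero coefficients
-- at its end.
DegBelow : ℕ → Poly → Set
DegBelow k p = ∀ i → k ≤ i → coeff p i ≡ + 0

degBelow-length : ∀ p → DegBelow (length p) p
degBelow-length [] i _ = ≡.refl
degBelow-length (a ∷ p) (suc i) (s≤s l) = degBelow-length p i l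

-- Induction on the number k of quotient digits still to be produced: each step takes the leading
-- coefficient c as a digit and subtracts c X^k times the divisor.
divStep-correct : ∀ k p d → length p ≡ k + length d →
  ∃ λ r → (reverse p ≋ reverse (+ 1 ∷ d) ⊗ reverse (divStep k p (+ 1 ∷ d)) ⊕ r) × DegBelow (length d) r
divStep-correct zero p d eq = reverse p , lemma (reverse p) (reverse (+ 1 ∷ d)) ,
  ≡.subst (λ l → DegBelow l (reverse p)) (≡.trans (List.length-reverse p) eq) (degBelow-length (reverse p))
  where
  lemma : ∀ p d → p ≋ d ⊗ [] ⊕ p
  lemma p d = trans (solve 2 (λ p d → p := d :* con (+ 0) :+ p) refl p d) (+ʳ (*ˡ const-0))
divStep-correct (suc k) (c ∷ p) d eq
  with r , e , l ← divStep-correct k (subMul c d p) d (≡.trans (length-subMul c d p) (ℕ.suc-injective eq))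
  = r , (begin
    reverse (c ∷ p)
      ≈⟨ reverse-∷ c p ⟩
    -- The leading term is C X^k times the leading 1 of the divisor; `subMul` takes away the rest of
    -- that multiple.
    reverse p ⊕ C ⊗ X ^ length p
      ≈⟨ +-cong (unsub (reverse p) (C ⊗ Xᵏ ⊗ reverse d)) (*ˡ (X^-cong-+ k (length d) eq′)) ⟩
    (reverse p ⊕ ⊖ (C ⊗ Xᵏ ⊗ reverse d)) ⊕ C ⊗ Xᵏ ⊗ reverse d ⊕ C ⊗ (Xᵏ ⊗ X ^ length d)
      ≈⟨ +ʳ (+ʳ (trans (sym (reverse-subMul c d p k eq′)) e)) ⟩
    (D ⊗ reverse q ⊕ r) ⊕ C ⊗ Xᵏ ⊗ reverse d ⊕ C ⊗ (Xᵏ ⊗ X ^ length d)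
      ≈⟨ collect D (reverse q) r C Xᵏ (reverse d) (X ^ length d) ⟩
    D ⊗ reverse q ⊕ C ⊗ Xᵏ ⊗ (reverse d ⊕ const (+ 1) ⊗ X ^ length d) ⊕ r
      ≈⟨ +ʳ (+ˡ (*ˡ (reverse-∷ (+ 1) d))) ⟨
    D ⊗ reverse q ⊕ C ⊗ Xᵏ ⊗ D ⊕ r
      ≈⟨ factor D (reverse q) (C ⊗ Xᵏ) r ⟩
    D ⊗ (reverse q ⊕ C ⊗ Xᵏ) ⊕ r
      ≡⟨ ≡.cong (λ l → D ⊗ (reverse q ⊕ C ⊗ X ^ l) ⊕ r) lq ⟨
    D ⊗ (reverse q ⊕ C ⊗ X ^ length q) ⊕ r
      ≈⟨ +ʳ (*ˡ (reverse-∷ c q)) ⟨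
    D ⊗ reverse (c ∷ q) ⊕ r
      ∎) , l
  where
  open ≋-Reasoning
  D q C Xᵏ : Poly
  D = reverse (+ 1 ∷ d)
  q = divStep k (subMul c d p) (+ 1 ∷ d)
  C = const c
  Xᵏ = X ^ k
  eq′ : length p ≡ k + length d
  eq′ = ℕ.suc-injective eq
  lq : length q ≡ k
  lq = length-divStep k (subMul c d p) (+ 1) d (≡.trans (length-subMul c d p) eq′)
  unsub : ∀ p x → p ≋ (p ⊕ ⊖ x) ⊕ x
  unsub = solve 2 (λ p x → p := (p :+ :- x) :+ x) refl
  collect : ∀ D q r c xk d xl →
    (D ⊗ q ⊕ r) ⊕ c ⊗ xk ⊗ d ⊕ c ⊗ (xk ⊗ xl) ≋ D ⊗ q ⊕ c ⊗ xk ⊗ (d ⊕ const (+ 1) ⊗ xl) ⊕ r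
  collect = solve 7 (λ D q r c xk d xl → (D :* q :+ r) :+ c :* xk :* d :+ c :* (xk :* xl) := D :* q :+ c :* xk :* (d :+ con (+ 1) :* xl) :+ r) refl
  factor : ∀ D q x r → D ⊗ q ⊕ x ⊗ D ⊕ r ≋ D ⊗ (q ⊕ x) ⊕ r
  factor = solve 4 (λ D q x r → D :* q :+ x :* D :+ r := D :* (q :+ x) :+ r) refl

-- Degree bounds, monic polynomials and uniqueness of division

degBelow-resp : ∀ {k p q} → p ≋ q → DegBelow k p → DegBelow k q
degBelow-resp e l i k≤i = ≡.trans (≡.sym (coeff-≡ e i)) (l i k≤i)

degBelow-≤ : ∀ {k l p} → k ≤ l → DegBelow k p → DegBelow l p
degBelow-≤ k≤l d i l≤i = d i (ℕ.≤-trans k≤l l≤i)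

degBelow-scale : ∀ {k} c p → DegBelow k p → DegBelow k (scaleₚ c p)
degBelow-scale c p d i k≤i = ≡.trans (coeff-scale c p i) (≡.trans (≡.cong (c ℤ.*_) (d i k≤i)) (ℤ.*-zeroʳ c))

degBelow-0 : ∀ {p} → DegBelow 0 p → p ≋ []
degBelow-0 d = coeffwise λ i → d i z≤n

-- Induction along the first factor: its head contributes a multiple of q, which is too short to
-- reach position d + k unless d = 0, and then the tail vanishes.
coeff-*ₚ-top : ∀ p q d k → DegBelow (suc d) p → DegBelow (suc k) q →
  coeff (p *ₚ q) (d + k) ≡ coeff p d ℤ.* coeff q k
coeff-*ₚ-top [] q d k p< q< = ≡.sym (ℤ.*-zeroˡ (coeff q k))
coeff-*ₚ-top (a ∷ p) q zero k p< q< = begin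
  coeff (scaleₚ a q +ₚ (+ 0 ∷ (p *ₚ q))) k             ≡⟨ coeff-+ (scaleₚ a q) (+ 0 ∷ (p *ₚ q)) k ⟩
  coeff (scaleₚ a q) k ℤ.+ coeff (+ 0 ∷ (p *ₚ q)) k    ≡⟨ ≡.cong₂ ℤ._+_ (coeff-scale a q k) (coeff-≡ 0∷pq≋[] k) ⟩
  a ℤ.* coeff q k ℤ.+ + 0                              ≡⟨ ℤ.+-identityʳ _ ⟩
  a ℤ.* coeff q k                                      ∎
  where
  open ≡.≡-Reasoning
  p≋[] : p ≋ []
  p≋[] = degBelow-0 λ i _ → p< (suc i) (s≤s z≤n)
  0∷pq≋[] : + 0 ∷ (p *ₚ q) ≋ []
  0∷pq≋[] = trans (∷-cong ≡.refl (*ₚ-cong {q = q} p≋[] refl)) 0∷[]≋[]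
coeff-*ₚ-top (a ∷ p) q (suc d) k p< q< = begin
  coeff (scaleₚ a q +ₚ (+ 0 ∷ (p *ₚ q))) (suc d + k)
    ≡⟨ coeff-+ (scaleₚ a q) (+ 0 ∷ (p *ₚ q)) (suc d + k) ⟩
  coeff (scaleₚ a q) (suc d + k) ℤ.+ coeff (p *ₚ q) (d + k)
    ≡⟨ ≡.cong₂ ℤ._+_ (degBelow-scale a q q< (suc d + k) (s≤s (ℕ.m≤n+m k d)))
                     (coeff-*ₚ-top p q d k (λ i l → p< (suc i) (s≤s l)) q<) ⟩
  + 0 ℤ.+ coeff p d ℤ.* coeff q k
    ≡⟨ ℤ.+-identityˡ _ ⟩
  coeff p d ℤ.* coeff q k ∎
  where open ≡.≡-Reasoning

-- A condition on the list itself rather than on coefficients, because long division takes the last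
-- entry as the leading coefficient.
Monic : Poly → Set
Monic p = ∃ λ p′ → p ≡ p′ ∷ʳ + 1

length-∷ʳ : ∀ (p : Poly) c → length (p ∷ʳ c) ≡ suc (length p)
length-∷ʳ p c = ≡.trans (List.length-++ p) (ℕ.+-comm (length p) 1)

coeff-∷ʳ : ∀ p c → coeff (p ∷ʳ c) (length p) ≡ c
coeff-∷ʳ [] c = ≡.refl
coeff-∷ʳ (a ∷ p) c = coeff-∷ʳ p c

degBelow-∷ʳ : ∀ p c → DegBelow (suc (length p)) (p ∷ʳ c)
degBelow-∷ʳ p c = ≡.subst (λ l → DegBelow l (p ∷ʳ c)) (length-∷ʳ p c) (degBelow-length (p ∷ʳ c))

monic≢0 : ∀ {p} → Monic p → ¬ p ≋ []
monic≢0 (p′ , ≡.refl) e with () ← ≡.trans (≡.sym (coeff-∷ʳ p′ (+ 1))) (coeff-≡ e (length p′))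

-- The top coefficient of the product is that of q, since the divisor is monic; it must vanish, so
-- any degree bound on q can be lowered until q is zero.
monic-multiple-degBelow : ∀ d q → DegBelow (length d) ((d ∷ʳ + 1) ⊗ q) → q ≋ []
monic-multiple-degBelow d q dq< = descend (length q) (degBelow-length q)
  where
  descend : ∀ k → DegBelow k q → q ≋ []
  descend zero q< = degBelow-0 q<
  descend (suc k) q< = descend k q<′
    where
    top : coeff q k ≡ + 0
    top = begin
      coeff q k                                              ≡⟨ ℤ.*-identityˡ _ ⟨
      + 1 ℤ.* coeff q k                                      ≡⟨ ≡.cong (ℤ._* coeff q k) (coeff-∷ʳ d (+ 1)) ⟨
      coeff (d ∷ʳ + 1) (length d) ℤ.* coeff q k              ≡⟨ coeff-*ₚ-top (d ∷ʳ + 1) q (length d) k (degBelow-∷ʳ d (+ 1)) q< ⟨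
      coeff ((d ∷ʳ + 1) *ₚ q) (length d + k)               ≡⟨ ≡.cong (λ p → coeff p (length d + k)) (⊗≡*ₚ (d ∷ʳ + 1) q) ⟨
      coeff ((d ∷ʳ + 1) ⊗ q) (length d + k)                ≡⟨ dq< (length d + k) (ℕ.m≤m+n (length d) k) ⟩
      + 0                                                    ∎
      where open ≡.≡-Reasoning
    q<′ : DegBelow k q
    q<′ i k≤i with ℕ.m≤n⇒m<n∨m≡n k≤i
    ... | inj₁ k<i = q< i k<i
    ... | inj₂ ≡.refl = top

⊕⊖≋[]⇒≋ : ∀ {p q} → p ⊕ ⊖ q ≋ [] → p ≋ q
⊕⊖≋[]⇒≋ {p} {q} e = begin
  p                ≈⟨ solve 2 (λ p q → p := (p :+ :- q) :+ q) refl p q ⟩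
  (p ⊕ ⊖ q) ⊕ q    ≈⟨ +ʳ e ⟩
  [] ⊕ q           ≈⟨ +-identityˡ q ⟩
  q                ∎
  where open ≋-Reasoning

≋⇒⊕⊖≋[] : ∀ {p q} → p ≋ q → p ⊕ ⊖ q ≋ []
≋⇒⊕⊖≋[] {p} {q} e = trans (+ʳ e) (-‿inverseʳ q)

monic-cancelˡ : ∀ {d p q} → Monic d → d ⊗ p ≋ d ⊗ q → p ≋ q
monic-cancelˡ {p = p} {q} (d , ≡.refl) e = ⊕⊖≋[]⇒≋ (monic-multiple-degBelow d (p ⊕ ⊖ q)
  (degBelow-resp (sym (trans (solve 3 (λ d p q → d :* (p :+ :- q) := d :* p :+ :- (d :* q)) refl (d ∷ʳ + 1) p q) (≋⇒⊕⊖≋[] e)))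
    (λ _ _ → ≡.refl)))

-- The remainder equals the divisor times s - q and has smaller degree than the divisor, which
-- forces s - q to vanish.
monic-remainder-unique : ∀ {d p q r} → p ≋ (d ∷ʳ + 1) ⊗ q ⊕ r → DegBelow (length d) r →
  ∀ {s} → (d ∷ʳ + 1) ⊗ s ≋ p → q ≋ s
monic-remainder-unique {d} {p} {q} {r} e r< {s} f = sym (⊕⊖≋[]⇒≋ (monic-multiple-degBelow d (s ⊕ ⊖ q)
  (degBelow-resp (sym (begin
    D ⊗ (s ⊕ ⊖ q)            ≈⟨ solve 3 (λ d s q → d :* (s :+ :- q) := d :* s :+ :- (d :* q)) refl D s q ⟩
    D ⊗ s ⊕ ⊖ (D ⊗ q)        ≈⟨ +ʳ (trans f e) ⟩
    D ⊗ q ⊕ r ⊕ ⊖ (D ⊗ q)    ≈⟨ solve 2 (λ x r → x :+ r :+ :- x := r) refl (D ⊗ q) r ⟩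
    r                        ∎)) r<)))
  where
  open ≋-Reasoning
  D : Poly
  D = d ∷ʳ + 1

reverse-∷ʳ : ∀ (p : Poly) c → reverse (p ∷ʳ c) ≡ c ∷ reverse p
reverse-∷ʳ p c = List.reverse-++ p (c ∷ [])

reverse-∷-reverse : ∀ (p : Poly) c → reverse (c ∷ reverse p) ≡ p ∷ʳ c
reverse-∷-reverse p c = ≡.trans (List.unfold-reverse c (reverse p)) (≡.cong (_∷ʳ c) (List.reverse-involutive p))

divide-with : ∀ p d k → length p ≡ k + length d →
  ∃ λ r → (p ≋ (d ∷ʳ + 1) ⊗ reverse (divStep k (reverse p) (+ 1 ∷ reverse d)) ⊕ r) × DegBelow (length d) r
divide-with p d k eq
  with r , e , r< ← divStep-correct k (reverse p) (reverse d)
         (≡.trans (List.length-reverse p) (≡.trans eq (≡.cong (k ℕ.+_) (≡.sym (List.length-reverse d)))))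
  = r , ≡.subst₂ (λ x y → x ≋ y ⊗ reverse (divStep k (reverse p) (+ 1 ∷ reverse d)) ⊕ r) (List.reverse-involutive p) (reverse-∷-reverse d (+ 1)) e
      , ≡.subst (λ l → DegBelow l r) (List.length-reverse d) r<

divide : ∀ p d → ∃₂ λ q r → (p ≋ (d ∷ʳ + 1) ⊗ q ⊕ r) × DegBelow (length d) r
divide p d with ℕ.≤-total (length p) (length d)
... | inj₁ p≤d = [] , p , sym (trans (+ʳ (zeroʳ (d ∷ʳ + 1))) (+-identityˡ p)) , degBelow-≤ {p = p} p≤d (degBelow-length p)
... | inj₂ d≤p = _ , divide-with p d (length p ∸ length d) (≡.sym (ℕ.m∸n+n≡m d≤p))

const-⊗-injective : ∀ {c r} → c ≢ + 0 → const c ⊗ r ≋ [] → r ≋ []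
const-⊗-injective {c} {r} c≢0 e = coeffwise λ i →
  [ (λ c≡0 → ⊥-elim (c≢0 c≡0)) , (λ r≡0 → r≡0) ]′
    (ℤ.i*j≡0⇒i≡0∨j≡0 c (≡.trans (≡.sym (coeff-scale c r i)) (coeff-≡ (trans (sym (const-* c r)) e) i)))

-- Divide p by b with remainder r. Then c r is the remainder of c p, which is 0 because b divides c
-- p; as c is nonzero, r is 0.
monic-∣-const-⊗ : ∀ {b c p q} → Monic b → c ≢ + 0 → b ⊗ q ≋ const c ⊗ p → ∃ λ s → b ⊗ s ≋ p
monic-∣-const-⊗ {b} {c} {p} {q} (b′ , ≡.refl) c≢0 e with s , r , f , r< ← divide p b′ = s , (begin
  b ⊗ s        ≈⟨ +-identityʳ _ ⟨
  b ⊗ s ⊕ []   ≈⟨ +ˡ r≋[] ⟨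
  b ⊗ s ⊕ r    ≈⟨ f ⟨
  p            ∎)
  where
  open ≋-Reasoning
  e′ : const c ⊗ p ≋ b ⊗ (const c ⊗ s) ⊕ const c ⊗ r
  e′ = trans (*ˡ f) (solve 4 (λ c b s r → c :* (b :* s :+ r) := b :* (c :* s) :+ c :* r) refl (const c) b s r)
  cs≋q : const c ⊗ s ≋ q
  cs≋q = monic-remainder-unique {b′} e′ (degBelow-resp (sym (const-* c r)) (degBelow-scale c r r<)) e
  r≋[] : r ≋ []
  r≋[] = const-⊗-injective c≢0 (begin
    const c ⊗ r                                               ≈⟨ solve 2 (λ x r → r := (x :+ r) :+ :- x) refl (b ⊗ (const c ⊗ s)) (const c ⊗ r) ⟩
    (b ⊗ (const c ⊗ s) ⊕ const c ⊗ r) ⊕ ⊖ (b ⊗ (const c ⊗ s)) ≈⟨ ≋⇒⊕⊖≋[] (trans (sym e′) (trans (sym e) (*ˡ (sym cs≋q)))) ⟩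
    []                                                        ∎)

-- Exactness of the computed quotient and monic products

divMonic-monic : ∀ {p d} → Monic p → Monic d → Monic (divMonic p d)
divMonic-monic {p} {d} (p′ , ≡.refl) (d′ , ≡.refl) = _ ,
  ≡.trans (divMonic≡ p d)
    (≡.trans (≡.cong₂ (λ x y → reverse (divStep (suc (length p ∸ length d)) x y)) (reverse-∷ʳ p′ (+ 1)) (reverse-∷ʳ d′ (+ 1)))
      (List.unfold-reverse (+ 1) (divStep (length p ∸ length d) (subMul (+ 1) (reverse d′) (reverse p′)) (+ 1 ∷ reverse d′))))

divMonic≡reverse : ∀ p d → divMonic p (d ∷ʳ + 1) ≡
  reverse (divStep (suc (length p ∸ suc (length d))) (reverse p) (+ 1 ∷ reverse d))
divMonic≡reverse p d = ≡.trans (divMonic≡ p (d ∷ʳ + 1))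
  (≡.cong₂ (λ l x → reverse (divStep (suc (length p ∸ l)) (reverse p) x)) (length-∷ʳ d (+ 1)) (reverse-∷ʳ d (+ 1)))

divMonic-exact : ∀ {p d q} → Monic p → Monic d → d ⊗ q ≋ p → d ⊗ divMonic p d ≋ p
divMonic-exact {p} {d} {q} p-monic (d′ , ≡.refl) e =
  trans (*ˡ (trans (reflexive (divMonic≡reverse p d′)) quotient≋q)) e
  where
  -- The number of division steps uses truncated subtraction and is right only if the divisor is no
  -- longer than p. Otherwise the exact quotient would be 0, against p being monic.
  d≤p : suc (length d′) ≤ length p
  d≤p with suc (length d′) ℕ.≤? length p
  ... | yes l = l
  ... | no ¬l = ⊥-elim (monic≢0 p-monic (trans (sym e) (trans (*ˡ q≋[]) (zeroʳ d))))
    where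
    q≋[] : q ≋ []
    q≋[] = monic-multiple-degBelow d′ q (degBelow-resp (sym e)
      (degBelow-≤ {p = p} (ℕ.≤-pred (ℕ.≰⇒> ¬l)) (degBelow-length p)))
  k : ℕ
  k = suc (length p ∸ suc (length d′))
  quotient≋q : reverse (divStep k (reverse p) (+ 1 ∷ reverse d′)) ≋ q
  quotient≋q with _ , f , r< ← divide-with p d′ k (≡.trans (≡.sym (ℕ.m∸n+n≡m d≤p)) (ℕ.+-suc _ _))
    = monic-remainder-unique {d′} f r< e

monic-1 : Monic (+ 1 ∷ [])
monic-1 = [] , ≡.refl

-- The lengths are tracked because `Monic` asks for equality of lists: a shorter or equally long
-- summand leaves the final entry untouched.
+ₚ-∷ʳ : ∀ p q c → length p ≤ length q → ∃ λ s → (p +ₚ (q ∷ʳ c) ≡ s ∷ʳ c) × (length s ≡ length q)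
+ₚ-∷ʳ [] q c _ = q , ≡.refl , ≡.refl
+ₚ-∷ʳ (a ∷ p) (b ∷ q) c (s≤s l) with s , e , f ← +ₚ-∷ʳ p q c l = _ ∷ s , ≡.cong (_ ∷_) e , ≡.cong suc f

1*ₚ-monic : ∀ q → ∃ λ s → ((+ 1 ∷ []) *ₚ (q ∷ʳ + 1) ≡ s ∷ʳ + 1) × (length s ≡ length q)
1*ₚ-monic [] = [] , ≡.refl , ≡.refl
1*ₚ-monic (b ∷ q) = _ ∷ map (+ 1 ℤ.*_) q , ≡.cong (_ ∷_) (scale-∷ʳ q) , ≡.cong suc (List.length-map _ q)
  where
  scale-∷ʳ : ∀ q → scaleₚ (+ 1) (q ∷ʳ + 1) +ₚ [] ≡ map (+ 1 ℤ.*_) q ∷ʳ + 1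
  scale-∷ʳ [] = ≡.refl
  scale-∷ʳ (c ∷ q) = ≡.cong (_ ∷_) (List.map-++ (+ 1 ℤ.*_) q (+ 1 ∷ []))

∷ʳ-*ₚ-∷ʳ : ∀ p q → ∃ λ s → ((p ∷ʳ + 1) *ₚ (q ∷ʳ + 1) ≡ s ∷ʳ + 1) × (length s ≡ length p + length q)
∷ʳ-*ₚ-∷ʳ [] q = 1*ₚ-monic q
∷ʳ-*ₚ-∷ʳ (a ∷ p) q
  with s , e , f ← ∷ʳ-*ₚ-∷ʳ p q
  with t , g , h ← +ₚ-∷ʳ (scaleₚ a (q ∷ʳ + 1)) (+ 0 ∷ s) (+ 1)
         (ℕ.≤-trans (ℕ.≤-reflexive (≡.trans (List.length-map _ (q ∷ʳ + 1)) (length-∷ʳ q (+ 1))))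
           (s≤s (ℕ.≤-trans (ℕ.m≤n+m (length q) (length p)) (ℕ.≤-reflexive (≡.sym f)))))
  = t , ≡.trans (≡.cong (λ x → scaleₚ a (q ∷ʳ + 1) +ₚ (+ 0 ∷ x)) e) g , ≡.trans h (≡.cong suc f)

monic-*ₚ : ∀ {p q} → Monic p → Monic q → Monic (p *ₚ q)
monic-*ₚ (p , ≡.refl) (q , ≡.refl) with s , e , _ ← ∷ʳ-*ₚ-∷ʳ p q = s , e

-- Divisibility and ideals in ℤ[X]

infix 4 _∣_
_∣_ : Poly → Poly → Set
p ∣ q = ∃ λ s → p ⊗ s ≋ q

X^_−1 : ℕ → Poly
X^ n −1 = X ^ n ⊕ ⊖ 1#

-- The sum 1 + z + ... + z^(k-1) in Horner form.
geometric : Poly → ℕ → Poly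
geometric z zero = []
geometric z (suc k) = 1# ⊕ z ⊗ geometric z k

geometric-sum : ∀ z k → (z ⊕ ⊖ 1#) ⊗ geometric z k ≋ z ^ k ⊕ ⊖ 1#
geometric-sum z zero = trans (zeroʳ (z ⊕ ⊖ 1#)) (sym (-‿inverseʳ 1#))
geometric-sum z (suc k) = begin
  (z ⊕ ⊖ 1#) ⊗ (1# ⊕ z ⊗ geometric z k)
    ≈⟨ solve 2 (λ z g → (z :+ :- con (+ 1)) :* (con (+ 1) :+ z :* g) := z :+ :- con (+ 1) :+ z :* ((z :+ :- con (+ 1)) :* g)) refl z (geometric z k) ⟩
  z ⊕ ⊖ 1# ⊕ z ⊗ ((z ⊕ ⊖ 1#) ⊗ geometric z k)
    ≈⟨ +ˡ (*ˡ (geometric-sum z k)) ⟩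
  z ⊕ ⊖ 1# ⊕ z ⊗ (z ^ k ⊕ ⊖ 1#)
    ≈⟨ solve 2 (λ z x → z :+ :- con (+ 1) :+ z :* (x :+ :- con (+ 1)) := z :* x :+ :- con (+ 1)) refl z (z ^ k) ⟩
  z ⊗ z ^ k ⊕ ⊖ 1#
    ∎
  where open ≋-Reasoning

-- Modulo z - 1 each of the k powers of z is 1.
geometric-mod : ∀ z k → ∃ λ w → geometric z k ≋ const (+ k) ⊕ (z ⊕ ⊖ 1#) ⊗ w
geometric-mod z zero = [] , sym (trans (+-cong const-0 (zeroʳ (z ⊕ ⊖ 1#))) (+-identityʳ []))
geometric-mod z (suc k) with w , e ← geometric-mod z k = const (+ k) ⊕ z ⊗ w , (begin
  1# ⊕ z ⊗ geometric z k
    ≈⟨ +ˡ (*ˡ e) ⟩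
  1# ⊕ z ⊗ (const (+ k) ⊕ (z ⊕ ⊖ 1#) ⊗ w)
    ≈⟨ solve 3 (λ z c w → con (+ 1) :+ z :* (c :+ (z :+ :- con (+ 1)) :* w)
                       := con (+ 1) :+ c :+ (z :+ :- con (+ 1)) :* (c :+ z :* w)) refl z (const (+ k)) w ⟩
  1# ⊕ const (+ k) ⊕ (z ⊕ ⊖ 1#) ⊗ (const (+ k) ⊕ z ⊗ w)
    ≈⟨ +ʳ (const-+ (+ 1) (+ k)) ⟨
  const (+ suc k) ⊕ (z ⊕ ⊖ 1#) ⊗ (const (+ k) ⊕ z ⊗ w)
    ∎)
  where open ≋-Reasoning

X^*−1 : ∀ g k → X^ g * k −1 ≋ X^ g −1 ⊗ geometric (X ^ g) k
X^*−1 g k = trans (+ʳ (sym (^-assocʳ X g k))) (sym (geometric-sum (X ^ g) k))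

X^−1-∣ : ∀ {g n} → g ∣ₙ n → X^ g −1 ∣ X^ n −1
X^−1-∣ {g} (divides k ≡.refl) = geometric (X ^ g) k , trans (sym (X^*−1 g k)) (reflexive (≡.cong X^_−1 (ℕ.*-comm g k)))

∣ₚ-trans : ∀ {p q r} → p ∣ q → q ∣ r → p ∣ r
∣ₚ-trans (s , e) (t , f) = s ⊗ t , trans (sym (*-assoc _ s t)) (trans (*ʳ e) f)

infix 4 _∈⟨_,_⟩
_∈⟨_,_⟩ : Poly → Poly → Poly → Set
z ∈⟨ a , b ⟩ = ∃₂ λ u v → u ⊗ a ⊕ v ⊗ b ≋ z

∣-∈ : ∀ {a b z w} → a ∣ z → b ∣ w → ∀ s t → s ⊗ z ⊕ t ⊗ w ∈⟨ a , b ⟩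
∣-∈ {a} {b} {z} {w} (x , e) (y , f) s t = s ⊗ x , t ⊗ y ,
  trans (solve 6 (λ s x a t y b → s :* x :* a :+ t :* y :* b := s :* (a :* x) :+ t :* (b :* y)) refl s x a t y b)
        (+-cong (*ˡ e) (*ˡ f))

∈-resp : ∀ {a b z w} → z ≋ w → z ∈⟨ a , b ⟩ → w ∈⟨ a , b ⟩
∈-resp e (u , v , f) = u , v , trans f e

∈-sym : ∀ {a b z} → z ∈⟨ a , b ⟩ → z ∈⟨ b , a ⟩
∈-sym {a} {b} (u , v , e) = v , u , trans (solve 2 (λ x y → y :+ x := x :+ y) refl (u ⊗ a) (v ⊗ b)) e

-- With t = g + s, X^t - 1 - X^g (X^s - 1) = X^g - 1.
X^−1-difference : ∀ {a b} g s t → g + s ≡ t → a ∣ X^ t −1 → b ∣ X^ s −1 → X^ g −1 ∈⟨ a , b ⟩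
X^−1-difference g s t eq a∣ b∣ = ∈-resp (begin
  1# ⊗ X^ t −1 ⊕ ⊖ (X ^ g) ⊗ X^ s −1
    ≈⟨ +ʳ (*ˡ (+ʳ (reflexive (≡.cong (X ^_) (≡.sym eq))))) ⟩
  1# ⊗ X^ g + s −1 ⊕ ⊖ (X ^ g) ⊗ X^ s −1
    ≈⟨ +ʳ (*ˡ (+ʳ (^-homo-* X g s))) ⟩
  1# ⊗ (X ^ g ⊗ X ^ s ⊕ ⊖ 1#) ⊕ ⊖ (X ^ g) ⊗ X^ s −1
    ≈⟨ solve 2 (λ x y → con (+ 1) :* (x :* y :+ :- con (+ 1)) :+ :- x :* (y :+ :- con (+ 1)) := x :+ :- con (+ 1)) refl (X ^ g) (X ^ s) ⟩
  X^ g −1 ∎) (∣-∈ a∣ b∣ 1# (⊖ (X ^ g)))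
  where open ≋-Reasoning

-- Bézout's identity over ℕ has two forms, according to which multiple is the larger; they differ by
-- swapping a and b.
X^gcd−1 : ∀ {a b} m n → a ∣ X^ m −1 → b ∣ X^ n −1 → X^ gcd m n −1 ∈⟨ a , b ⟩
X^gcd−1 m n a∣ b∣ with Bézout.identity (gcd-GCD m n)
... | Bézout.Identity.+- x y eq = X^−1-difference (gcd m n) (y * n) (x * m) eq
        (∣ₚ-trans a∣ (X^−1-∣ (divides x ≡.refl))) (∣ₚ-trans b∣ (X^−1-∣ (divides y ≡.refl)))
... | Bézout.Identity.-+ x y eq = ∈-sym (X^−1-difference (gcd m n) (x * m) (y * n) eq
        (∣ₚ-trans b∣ (X^−1-∣ (divides y ≡.refl))) (∣ₚ-trans a∣ (X^−1-∣ (divides x ≡.refl))))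

-- Coprimality over ℚ, in a form that stays inside ℤ[X].
Comaximal : Poly → Poly → Set
Comaximal a b = ∃ λ c → c ≢ + 0 × const c ∈⟨ a , b ⟩

comaximal-sym : ∀ {a b} → Comaximal a b → Comaximal b a
comaximal-sym (c , c≢0 , m) = c , c≢0 , ∈-sym m

comaximal-1 : ∀ b → Comaximal 1# b
comaximal-1 b = + 1 , (λ ()) , 1# , [] , trans (+-cong (*-identityʳ 1#) (zeroˡ b)) (+-identityʳ 1#)

-- Multiply u a + v b = c by c′ and, in the term u a c′, replace c′ by u′ a′ + v′ b.
comaximal-⊗ : ∀ {a a′ b} → Comaximal a b → Comaximal a′ b → Comaximal (a ⊗ a′) b
comaximal-⊗ {a} {a′} {b} (c , c≢0 , u , v , e) (c′ , c′≢0 , u′ , v′ , e′) =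
  c ℤ.* c′ , (λ eq → [ c≢0 , c′≢0 ]′ (ℤ.i*j≡0⇒i≡0∨j≡0 c eq)) ,
  u ⊗ u′ , v ⊗ const c′ ⊕ u ⊗ a ⊗ v′ , (begin
    u ⊗ u′ ⊗ (a ⊗ a′) ⊕ (v ⊗ const c′ ⊕ u ⊗ a ⊗ v′) ⊗ b
      ≈⟨ solve 8 (λ u u′ a a′ v c′ v′ b → u :* u′ :* (a :* a′) :+ (v :* c′ :+ u :* a :* v′) :* b
           := u :* a :* (u′ :* a′ :+ v′ :* b) :+ v :* b :* c′) refl u u′ a a′ v (const c′) v′ b ⟩
    u ⊗ a ⊗ (u′ ⊗ a′ ⊕ v′ ⊗ b) ⊕ v ⊗ b ⊗ const c′
      ≈⟨ +ʳ (*ˡ e′) ⟩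
    u ⊗ a ⊗ const c′ ⊕ v ⊗ b ⊗ const c′
      ≈⟨ solve 3 (λ x y c → x :* c :+ y :* c := (x :+ y) :* c) refl (u ⊗ a) (v ⊗ b) (const c′) ⟩
    (u ⊗ a ⊕ v ⊗ b) ⊗ const c′
      ≈⟨ *ʳ e ⟩
    const c ⊗ const c′
      ≈⟨ const-*-const c c′ ⟨
    const (c ℤ.* c′)
      ∎)
  where open ≋-Reasoning

-- If f = a q = b t and u a + v b = c, then b (u t + v q) = c q, so the monic b divides q itself.
comaximal-∣ : ∀ {a b f} → Monic b → Comaximal a b → a ∣ f → b ∣ f → a ⊗ b ∣ f
comaximal-∣ {a} {b} {f} b-monic (c , c≢0 , u , v , e) (q , aq) (t , bt) =
  let s , bs = monic-∣-const-⊗ {q = u ⊗ t ⊕ v ⊗ q} b-monic c≢0 bw in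
  s , trans (*-assoc a b s) (trans (*ˡ bs) aq)
  where
  open ≋-Reasoning
  bw : b ⊗ (u ⊗ t ⊕ v ⊗ q) ≋ const c ⊗ q
  bw = begin
    b ⊗ (u ⊗ t ⊕ v ⊗ q)         ≈⟨ solve 5 (λ b u t v q → b :* (u :* t :+ v :* q) := u :* (b :* t) :+ v :* b :* q) refl b u t v q ⟩
    u ⊗ (b ⊗ t) ⊕ v ⊗ b ⊗ q     ≈⟨ +ʳ (*ˡ (trans bt (sym aq))) ⟩
    u ⊗ (a ⊗ q) ⊕ v ⊗ b ⊗ q     ≈⟨ solve 5 (λ u a q v b → u :* (a :* q) :+ v :* b :* q := (u :* a :+ v :* b) :* q) refl u a q v b ⟩
    (u ⊗ a ⊕ v ⊗ b) ⊗ q         ≈⟨ *ʳ e ⟩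
    const c ⊗ q                 ∎

∏ : (ℕ → Poly) → ℕ → Poly
∏ f zero = 1#
∏ f (suc n) = ∏ f n ⊗ f (suc n)

∏-comaximal : ∀ f n {b} → (∀ d → 1 ≤ d → d ≤ n → Comaximal (f d) b) → Comaximal (∏ f n) b
∏-comaximal f zero h = comaximal-1 _
∏-comaximal f (suc n) h = comaximal-⊗
  (∏-comaximal f n λ d 1≤d d≤n → h d 1≤d (ℕ.m≤n⇒m≤1+n d≤n)) (h (suc n) (s≤s z≤n) ℕ.≤-refl)

∏-∣ : ∀ f n {F} → (∀ d → 1 ≤ d → d ≤ n → Monic (f d)) → (∀ d → 1 ≤ d → d ≤ n → f d ∣ F) →
  (∀ d e → 1 ≤ d → d < e → e ≤ n → Comaximal (f d) (f e)) → ∏ f n ∣ F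
∏-∣ f zero {F} _ _ _ = F , *-identityˡ F
∏-∣ f (suc n) monic divs comax = comaximal-∣ (monic (suc n) (s≤s z≤n) ℕ.≤-refl)
  (∏-comaximal f n λ d 1≤d d≤n → comax d (suc n) 1≤d (s≤s d≤n) ℕ.≤-refl)
  (∏-∣ f n (λ d 1≤d d≤n → monic d 1≤d (ℕ.m≤n⇒m≤1+n d≤n)) (λ d 1≤d d≤n → divs d 1≤d (ℕ.m≤n⇒m≤1+n d≤n))
    λ d e 1≤d d<e e≤n → comax d e 1≤d d<e (ℕ.m≤n⇒m≤1+n e≤n))
  (divs (suc n) (s≤s z≤n) ℕ.≤-refl)

∏-mono-∣ : ∀ f g n → (∀ d → f d ∣ g d) → ∏ f n ∣ ∏ g n
∏-mono-∣ f g zero h = 1# , *-identityˡ 1#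
∏-mono-∣ f g (suc n) h with s , e ← ∏-mono-∣ f g n h | t , e′ ← h (suc n) =
  s ⊗ t , trans (solve 4 (λ a b s t → a :* b :* (s :* t) := a :* s :* (b :* t)) refl (∏ f n) (f (suc n)) s t) (*-cong e e′)

∏-extend : ∀ f {m n} → m ℕ.≤′ n → (∀ d → m < d → f d ≋ 1#) → ∏ f n ≋ ∏ f m
∏-extend f ℕ.≤′-refl h = refl
∏-extend f (ℕ.≤′-step {n} m≤n) h =
  trans (*-cong (∏-extend f m≤n h) (h (suc n) (s≤s (ℕ.≤′⇒≤ m≤n)))) (*-identityʳ _)

-- Cyclotomic polynomials

xⁿ-1≋ : ∀ n → xⁿ-1 n ≋ X^ n −1
xⁿ-1≋ zero = sym (-‿inverseʳ 1#)
xⁿ-1≋ (suc n) = begin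
  -[1+ 0 ] ∷ (replicate n (+ 0) ∷ʳ + 1)                ≈⟨ ∷-decompose -[1+ 0 ] _ ⟩
  const -[1+ 0 ] ⊕ X ⊗ (replicate n (+ 0) ∷ʳ + 1)      ≈⟨ +-cong (const-neg (+ 1)) (*ˡ (monomial n)) ⟩
  ⊖ 1# ⊕ X ⊗ X ^ n                                     ≈⟨ solve 2 (λ x y → x :+ y := y :+ x) refl (⊖ 1#) (X ⊗ X ^ n) ⟩
  X^ suc n −1                                          ∎
  where
  open ≋-Reasoning
  monomial : ∀ n → replicate n (+ 0) ∷ʳ + 1 ≋ X ^ n
  monomial zero = reflexive (≡.sym (const≡∷[] (+ 1)))
  monomial (suc n) = trans (sym (X-* _)) (*ˡ (monomial n))

xⁿ-1-monic : ∀ n → Monic (xⁿ-1 (suc n))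
xⁿ-1-monic n = -[1+ 0 ] ∷ replicate n (+ 0) , ≡.refl

X^−1-cancelˡ : ∀ n {p q} → X^ suc n −1 ⊗ p ≋ X^ suc n −1 ⊗ q → p ≋ q
X^−1-cancelˡ n e = monic-cancelˡ (xⁿ-1-monic n) (trans (*ʳ (xⁿ-1≋ (suc n))) (trans e (*ʳ (sym (xⁿ-1≋ (suc n))))))

prodₚ-monic : ∀ {ps} → All Monic ps → Monic (prodₚ ps)
prodₚ-monic [] = monic-1
prodₚ-monic (m ∷ ms) = monic-*ₚ m (prodₚ-monic ms)

prodₚ-++ : ∀ ps qs → prodₚ (ps ++ qs) ≋ prodₚ ps ⊗ prodₚ qs
prodₚ-++ [] qs = trans (sym (*-identityˡ (prodₚ qs))) (*ʳ (reflexive (const≡∷[] (+ 1))))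
prodₚ-++ (p ∷ ps) qs = begin
  p *ₚ prodₚ (ps ++ qs)           ≡⟨ ⊗≡*ₚ p _ ⟨
  p ⊗ prodₚ (ps ++ qs)            ≈⟨ *ˡ (prodₚ-++ ps qs) ⟩
  p ⊗ (prodₚ ps ⊗ prodₚ qs)       ≈⟨ *-assoc p _ _ ⟨
  p ⊗ prodₚ ps ⊗ prodₚ qs         ≡⟨ ≡.cong (_⊗ prodₚ qs) (⊗≡*ₚ p _) ⟩
  (p *ₚ prodₚ ps) ⊗ prodₚ qs      ∎
  where open ≋-Reasoning

opaque
  -- Opaque, since unfolding Φ during conversion checking is expensive.
  cyclotomic : ℕ → Poly
  cyclotomic = Φ

  -- Non-divisors contribute a factor 1, so a product over the divisors of n becomes one over a full
  -- range of indices, and such products for different n can be compared factor by factor.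
  Φ-if-∣ : ℕ → ℕ → Poly
  Φ-if-∣ n d = if does (d ∣? n) then cyclotomic d else 1#

  Φ-if-∣-yes : ∀ {n d} → d ∣ₙ n → Φ-if-∣ n d ≡ cyclotomic d
  Φ-if-∣-yes {n} {d} d∣n rewrite dec-true (d ∣? n) d∣n = ≡.refl

  Φ-if-∣-no : ∀ {n d} → ¬ d ∣ₙ n → Φ-if-∣ n d ≡ 1#
  Φ-if-∣-no {n} {d} d∤n rewrite dec-false (d ∣? n) d∤n = ≡.refl

prodₚ-Φ-filter : ∀ n m → prodₚ (map cyclotomic (filter (_∣? n) (map suc (upTo m)))) ≋ ∏ (Φ-if-∣ n) m
prodₚ-Φ-filter n zero = reflexive (≡.sym (const≡∷[] (+ 1)))
prodₚ-Φ-filter n (suc m) = begin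
  prodₚ (map cyclotomic (filter (_∣? n) (map suc (upTo (suc m)))))
    ≡⟨ ≡.cong (λ l → prodₚ (map cyclotomic (filter (_∣? n) (map suc l)))) (List.upTo-∷ʳ m) ⟨
  prodₚ (map cyclotomic (filter (_∣? n) (map suc (upTo m ∷ʳ m))))
    ≡⟨ ≡.cong (λ l → prodₚ (map cyclotomic (filter (_∣? n) l))) (List.map-++ suc (upTo m) (m ∷ [])) ⟩
  prodₚ (map cyclotomic (filter (_∣? n) (map suc (upTo m) ∷ʳ suc m)))
    ≡⟨ ≡.cong (λ l → prodₚ (map cyclotomic l)) (List.filter-++ (_∣? n) (map suc (upTo m)) (suc m ∷ [])) ⟩
  prodₚ (map cyclotomic (filter (_∣? n) (map suc (upTo m)) ++ filter (_∣? n) (suc m ∷ [])))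
    ≡⟨ ≡.cong prodₚ (List.map-++ cyclotomic (filter (_∣? n) (map suc (upTo m))) _) ⟩
  prodₚ (map cyclotomic (filter (_∣? n) (map suc (upTo m))) ++ map cyclotomic (filter (_∣? n) (suc m ∷ [])))
    ≈⟨ prodₚ-++ (map cyclotomic (filter (_∣? n) (map suc (upTo m)))) _ ⟩
  prodₚ (map cyclotomic (filter (_∣? n) (map suc (upTo m)))) ⊗ prodₚ (map cyclotomic (filter (_∣? n) (suc m ∷ [])))
    ≈⟨ *-cong (prodₚ-Φ-filter n m) last ⟩
  ∏ (Φ-if-∣ n) (suc m)
    ∎
  where
  open ≋-Reasoning
  last : prodₚ (map cyclotomic (filter (_∣? n) (suc m ∷ []))) ≋ Φ-if-∣ n (suc m)
  last with suc m ∣? n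
  ... | yes m∣n rewrite Φ-if-∣-yes m∣n | List.filter-accept (_∣? n) {xs = []} m∣n = trans (reflexive (≡.trans (≡.sym (⊗≡*ₚ (cyclotomic (suc m)) _)) (≡.cong (cyclotomic (suc m) ⊗_) (≡.sym (const≡∷[] (+ 1)))))) (*-identityʳ (cyclotomic (suc m)))
  ... | no m∤n rewrite Φ-if-∣-no m∤n | List.filter-reject (_∣? n) {xs = []} m∤n = reflexive (≡.sym (const≡∷[] (+ 1)))

properDivisors-bounds : ∀ n → All (λ d → 1 ≤ d × d ≤ n) (properDivisors (suc n))
properDivisors-bounds n = All.filter⁺ (_∣? suc n) (All.map⁺ (All.applyUpTo⁺₁ _ n λ i<n → s≤s z≤n , i<n))

-- The recursion descends to proper divisors, so any fuel of at least n gives the same polynomial.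
cycAux-fuel : ∀ k l n → 1 ≤ n → n ≤ k → n ≤ l → cycAux k n ≡ cycAux l n
cycAux-fuel (suc k) (suc l) (suc n) _ (s≤s n≤k) (s≤s n≤l) =
  ≡.cong (λ ps → divMonic (xⁿ-1 (suc n)) (prodₚ ps)) (List.map-cong-local (All.map
    (λ {d} (1≤d , d≤n) → cycAux-fuel k l d 1≤d (ℕ.≤-trans d≤n n≤k) (ℕ.≤-trans d≤n n≤l))
    (properDivisors-bounds n)))

opaque
  unfolding cyclotomic

  cyclotomic-suc : ∀ n → cyclotomic (suc n) ≡ divMonic (xⁿ-1 (suc n)) (prodₚ (map cyclotomic (properDivisors (suc n))))
  cyclotomic-suc n = ≡.cong (λ ps → divMonic (xⁿ-1 (suc n)) (prodₚ ps)) (List.map-cong-local (All.map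
    (λ {d} (1≤d , d≤n) → cycAux-fuel n d d 1≤d d≤n ℕ.≤-refl) (properDivisors-bounds n)))

-- The index is shifted: the record concerns the cyclotomic polynomial of order n + 1, whose order
-- is thus positive.
record IsCyclotomic (n : ℕ) : Set where
  field
    monic : Monic (cyclotomic (suc n))
    factorisation : cyclotomic (suc n) ⊗ ∏ (Φ-if-∣ (suc n)) n ≋ X^ suc n −1
open IsCyclotomic

Φ∣X^−1 : ∀ {n} → IsCyclotomic n → cyclotomic (suc n) ∣ X^ suc n −1
Φ∣X^−1 {n} c = ∏ (Φ-if-∣ (suc n)) n , factorisation c

Φ-if-∣-mono : ∀ {m n} → m ∣ₙ n → ∀ d → Φ-if-∣ m d ∣ Φ-if-∣ n d
Φ-if-∣-mono {m} {n} m∣n d with d ∣? m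
... | no d∤m rewrite Φ-if-∣-no d∤m = _ , *-identityˡ (Φ-if-∣ n d)
... | yes d∣m rewrite Φ-if-∣-yes d∣m | Φ-if-∣-yes (∣-trans d∣m m∣n) = 1# , *-identityʳ (cyclotomic d)

-- Write G and N for the orders `suc g` and `suc n`. The divisors of G are proper divisors of N, so
-- Φ_N (X^G - 1) divides X^N - 1, which is (X^G - 1) times the geometric sum; then X^G - 1 is
-- cancelled.
Φ∣geometric : ∀ {g n k} → IsCyclotomic g → IsCyclotomic n → suc g < suc n → suc n ≡ suc g * k →
  cyclotomic (suc n) ∣ geometric (X ^ suc g) k
Φ∣geometric {g} {n} {k} cg cn (s≤s g<n) eq
  with w , e ← ∏-mono-∣ (Φ-if-∣ (suc g)) (Φ-if-∣ (suc n)) n (Φ-if-∣-mono (divides k (≡.trans eq (ℕ.*-comm (suc g) k))))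
  = w , X^−1-cancelˡ g (begin
    X^ suc g −1 ⊗ (cyclotomic (suc n) ⊗ w)
      ≈⟨ *ʳ (factorisation cg) ⟨
    cyclotomic (suc g) ⊗ ∏ (Φ-if-∣ (suc g)) g ⊗ (cyclotomic (suc n) ⊗ w)
      ≡⟨ ≡.cong (λ p → p ⊗ ∏ (Φ-if-∣ (suc g)) g ⊗ (cyclotomic (suc n) ⊗ w)) (Φ-if-∣-yes (∣-refl {suc g})) ⟨
    Φ-if-∣ (suc g) (suc g) ⊗ ∏ (Φ-if-∣ (suc g)) g ⊗ (cyclotomic (suc n) ⊗ w)
      ≈⟨ solve 4 (λ x y z w → x :* y :* (z :* w) := z :* (y :* x :* w)) refl (Φ-if-∣ (suc g) (suc g)) (∏ (Φ-if-∣ (suc g)) g) (cyclotomic (suc n)) w ⟩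
    cyclotomic (suc n) ⊗ (∏ (Φ-if-∣ (suc g)) (suc g) ⊗ w)
      -- Indices above `suc g` do not divide it, so lengthening the product up to n adds only
      -- factors 1.
      ≈⟨ *ˡ (*ʳ (∏-extend (Φ-if-∣ (suc g)) (ℕ.≤⇒≤′ g<n) λ d g<d → reflexive (Φ-if-∣-no λ d∣g → ℕ.<⇒≱ g<d (∣⇒≤ d∣g)))) ⟨
    cyclotomic (suc n) ⊗ (∏ (Φ-if-∣ (suc g)) n ⊗ w)
      ≈⟨ *ˡ e ⟩
    cyclotomic (suc n) ⊗ ∏ (Φ-if-∣ (suc n)) n
      ≈⟨ factorisation cn ⟩
    X^ suc n −1
      ≡⟨ ≡.cong X^_−1 eq ⟩
    X^ suc g * k −1
      ≈⟨ X^*−1 (suc g) k ⟩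
    X^ suc g −1 ⊗ geometric (X ^ suc g) k
      ∎)
  where open ≋-Reasoning

Φ-comaximal : ∀ {m n} → (∀ {d} → d ≤ n → IsCyclotomic d) → m < n →
  Comaximal (cyclotomic (suc m)) (cyclotomic (suc n))
-- The gcd is passed as a variable so that it can be split into zero and successor.
Φ-comaximal {m} {n} cyc m<n = at-gcd (gcd (suc m) (suc n))
  (gcd[m,n]≢0 (suc m) (suc n) (inj₁ λ ())) (gcd[m,n]∣m (suc m) (suc n)) (gcd[m,n]∣n (suc m) (suc n))
  (X^gcd−1 (suc m) (suc n) (Φ∣X^−1 (cyc (ℕ.<⇒≤ m<n))) (Φ∣X^−1 (cyc ℕ.≤-refl)))
  where
  open ≋-Reasoning
  A B : Poly
  A = cyclotomic (suc m)
  B = cyclotomic (suc n)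
  at-gcd : ∀ g → g ≢ 0 → g ∣ₙ suc m → g ∣ₙ suc n → X^ g −1 ∈⟨ A , B ⟩ → Comaximal A B
  at-gcd zero g≢0 _ _ _ = ⊥-elim (g≢0 ≡.refl)
  -- From B s = k + (X^(g+1) - 1) w and X^(g+1) - 1 = u A + v B one gets k = B s - (u A + v B) w.
  at-gcd (suc g) _ g∣m (divides k n≡kg) (u , v , e) = + k , k≢0 , ⊖ (w ⊗ u) , s ⊕ ⊖ (w ⊗ v) , (begin
    ⊖ (w ⊗ u) ⊗ A ⊕ (s ⊕ ⊖ (w ⊗ v)) ⊗ B
      ≈⟨ solve 6 (λ w u a s v b → :- (w :* u) :* a :+ (s :+ :- (w :* v)) :* b := b :* s :+ :- ((u :* a :+ v :* b) :* w)) refl w u A s v B ⟩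
    B ⊗ s ⊕ ⊖ ((u ⊗ A ⊕ v ⊗ B) ⊗ w)
      ≈⟨ +-cong (trans (proj₂ B∣geometric) (proj₂ (geometric-mod (X ^ suc g) k))) (-‿cong (*ʳ e)) ⟩
    const (+ k) ⊕ X^ suc g −1 ⊗ w ⊕ ⊖ (X^ suc g −1 ⊗ w)
      ≈⟨ solve 2 (λ x y → x :+ y :+ :- y := x) refl (const (+ k)) (X^ suc g −1 ⊗ w) ⟩
    const (+ k)
      ∎)
    where
    g≤m : g ≤ m
    g≤m = ℕ.≤-pred (∣⇒≤ g∣m)
    k≢0 : + k ≢ + 0
    k≢0 k≡0 = ℕ.1+n≢0 (≡.trans n≡kg (≡.cong (_* suc g) (ℤ.+-injective k≡0)))
    w : Poly
    w = proj₁ (geometric-mod (X ^ suc g) k)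
    B∣geometric : B ∣ geometric (X ^ suc g) k
    B∣geometric = Φ∣geometric (cyc (ℕ.≤-trans g≤m (ℕ.<⇒≤ m<n))) (cyc ℕ.≤-refl)
      (s≤s (ℕ.≤-<-trans g≤m m<n)) (≡.trans n≡kg (ℕ.*-comm k (suc g)))
    s : Poly
    s = proj₁ B∣geometric

-- By strong induction the earlier factors are monic, pairwise comaximal divisors of the dividend.
-- Their product therefore divides it, and the long division is exact.
isCyclotomic : ∀ n → IsCyclotomic n
isCyclotomic = <-rec IsCyclotomic step
  where
  step : ∀ n → (∀ {m} → m < n → IsCyclotomic m) → IsCyclotomic n
  step n rec = record
    { monic = ≡.subst Monic (≡.sym (cyclotomic-suc n)) (divMonic-monic (xⁿ-1-monic n) D-monic)
    ; factorisation = begin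
        cyclotomic (suc n) ⊗ ∏ (Φ-if-∣ (suc n)) n   ≈⟨ *-comm _ _ ⟩
        ∏ (Φ-if-∣ (suc n)) n ⊗ cyclotomic (suc n)   ≈⟨ *-cong (sym D≋) (reflexive (cyclotomic-suc n)) ⟩
        D ⊗ divMonic (xⁿ-1 (suc n)) D      ≈⟨ divMonic-exact (xⁿ-1-monic n) D-monic D-divides ⟩
        xⁿ-1 (suc n)                       ≈⟨ xⁿ-1≋ (suc n) ⟩
        X^ suc n −1                        ∎
    }
    where
    open ≋-Reasoning
    D : Poly
    D = prodₚ (map cyclotomic (properDivisors (suc n)))
    D≋ : D ≋ ∏ (Φ-if-∣ (suc n)) n
    D≋ = prodₚ-Φ-filter (suc n) n
    D-monic : Monic D
    D-monic = prodₚ-monic (All.map⁺ (All.map (λ { {suc d} (_ , d<n) → monic (rec d<n) }) (properDivisors-bounds n)))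
    factor-monic : ∀ d → 1 ≤ d → d ≤ n → Monic (Φ-if-∣ (suc n) d)
    factor-monic (suc d) _ d<n with suc d ∣? suc n
    ... | yes d∣n rewrite Φ-if-∣-yes d∣n = monic (rec d<n)
    ... | no d∤n rewrite Φ-if-∣-no d∤n | const≡∷[] (+ 1) = monic-1
    factor-∣ : ∀ d → 1 ≤ d → d ≤ n → Φ-if-∣ (suc n) d ∣ X^ suc n −1
    factor-∣ (suc d) _ d<n with suc d ∣? suc n
    ... | yes d∣n rewrite Φ-if-∣-yes d∣n = ∣ₚ-trans (Φ∣X^−1 (rec d<n)) (X^−1-∣ d∣n)
    ... | no d∤n rewrite Φ-if-∣-no d∤n = _ , *-identityˡ _
    factors-comaximal : ∀ d e → 1 ≤ d → d < e → e ≤ n → Comaximal (Φ-if-∣ (suc n) d) (Φ-if-∣ (suc n) e)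
    factors-comaximal (suc d) (suc e) _ (s≤s d<e) e<n with suc d ∣? suc n | suc e ∣? suc n
    ... | no d∤n | _ rewrite Φ-if-∣-no d∤n = comaximal-1 _
    ... | yes _ | no e∤n rewrite Φ-if-∣-no e∤n = comaximal-sym (comaximal-1 _)
    ... | yes d∣n | yes e∣n rewrite Φ-if-∣-yes d∣n | Φ-if-∣-yes e∣n =
      Φ-comaximal (λ i≤e → rec (ℕ.≤-<-trans i≤e e<n)) d<e
    D-divisor : ∏ (Φ-if-∣ (suc n)) n ∣ X^ suc n −1
    D-divisor = ∏-∣ (Φ-if-∣ (suc n)) n factor-monic factor-∣ factors-comaximal
    D-divides : D ⊗ proj₁ D-divisor ≋ xⁿ-1 (suc n)
    D-divides = trans (*ʳ D≋) (trans (proj₂ D-divisor) (sym (xⁿ-1≋ (suc n))))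

cyclotomic∣geometric : ∀ g k → 1 ≤ g → 2 ≤ k → cyclotomic (g * k) ∣ geometric (X ^ g) k
cyclotomic∣geometric (suc g) (suc zero) _ (s≤s ())
cyclotomic∣geometric (suc g) (suc (suc k)) _ _ =
  Φ∣geometric (isCyclotomic g) (isCyclotomic _) (ℕ.m<m*n (suc g) (suc (suc k)) (s≤s (s≤s z≤n))) ≡.refl

-- Congruences and sums of powers

∣-resp : ∀ {p q r} → q ≋ r → p ∣ q → p ∣ r
∣-resp e (s , f) = s , trans f e

module Modulo (P : Poly) where

  infix 4 _≈_
  record _≈_ (p q : Poly) : Set where
    constructor mod
    field divides-difference : P ∣ p ⊕ ⊖ q
  open _≈_ public

  ≋⇒≈ : ∀ {p q} → p ≋ q → p ≈ q
  ≋⇒≈ e = mod ([] , trans (zeroʳ P) (sym (≋⇒⊕⊖≋[] e)))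

  ≈-sym : ∀ {p q} → p ≈ q → q ≈ p
  ≈-sym {p} {q} (mod (s , e)) = mod (⊖ s , trans (solve 2 (λ P s → P :* (:- s) := :- (P :* s)) refl P s)
    (trans (-‿cong e) (solve 2 (λ p q → :- (p :+ :- q) := q :+ :- p) refl p q)))

  ≈-trans : ∀ {p q r} → p ≈ q → q ≈ r → p ≈ r
  ≈-trans {p} {q} {r} (mod (s , e)) (mod (t , f)) = mod (s ⊕ t ,
    trans (solve 3 (λ P s t → P :* (s :+ t) := P :* s :+ P :* t) refl P s t)
      (trans (+-cong e f) (solve 3 (λ p q r → (p :+ :- q) :+ (q :+ :- r) := p :+ :- r) refl p q r)))

  ⊕-cong : ∀ {p p′ q q′} → p ≈ p′ → q ≈ q′ → p ⊕ q ≈ p′ ⊕ q′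
  ⊕-cong {p} {p′} {q} {q′} (mod (s , e)) (mod (t , f)) = mod (s ⊕ t ,
    trans (solve 3 (λ P s t → P :* (s :+ t) := P :* s :+ P :* t) refl P s t)
      (trans (+-cong e f) (solve 4 (λ p p′ q q′ → (p :+ :- p′) :+ (q :+ :- q′) := (p :+ q) :+ :- (p′ :+ q′)) refl p p′ q q′)))

  ⊗-congˡ : ∀ r {p q} → p ≈ q → r ⊗ p ≈ r ⊗ q
  ⊗-congˡ r {p} {q} (mod (s , e)) = mod (r ⊗ s ,
    trans (solve 3 (λ P r s → P :* (r :* s) := r :* (P :* s)) refl P r s)
      (trans (*ˡ e) (solve 3 (λ r p q → r :* (p :+ :- q) := r :* p :+ :- (r :* q)) refl r p q)))

  setoid : Setoid 0ℓ 0ℓ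
  setoid = record
    { Carrier = Poly ; _≈_ = _≈_
    ; isEquivalence = record { refl = ≋⇒≈ refl ; sym = ≈-sym ; trans = ≈-trans } }

  module ≈-Reasoning where
    open import Relation.Binary.Reasoning.Setoid setoid public

  ∣⇒≈[] : ∀ {p} → P ∣ p → p ≈ []
  ∣⇒≈[] {p} P∣p = mod (∣-resp (sym (trans (+ˡ (sym (-‿cong const-0))) (solve 1 (λ p → p :+ :- con (+ 0) := p) refl p))) P∣p)

-- Sums of powers over lists of exponents

powerSum : Poly → List ℕ → Poly
powerSum y [] = []
powerSum y (e ∷ es) = y ^ e ⊕ powerSum y es

powerSum-++ : ∀ y ds es → powerSum y (ds ++ es) ≋ powerSum y ds ⊕ powerSum y es
powerSum-++ y [] es = sym (+-identityˡ _)
powerSum-++ y (d ∷ ds) es = trans (+ˡ (powerSum-++ y ds es)) (sym (+-assoc (y ^ d) _ _))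

^-cong-≡ : ∀ y {d e} → d ≡ e → y ^ d ≋ y ^ e
^-cong-≡ y ≡.refl = refl

-- The shift is a pointwise equation on exponents, so that it also undoes shifts written with
-- truncated subtraction.
⊗-powerSum : ∀ y d (f g : ℕ → ℕ) n → (∀ i → i < n → d + f i ≡ g i) →
  y ^ d ⊗ powerSum y (applyUpTo f n) ≋ powerSum y (applyUpTo g n)
⊗-powerSum y d f g zero h = zeroʳ (y ^ d)
⊗-powerSum y d f g (suc n) h = begin
  y ^ d ⊗ (y ^ f 0 ⊕ powerSum y (applyUpTo (λ i → f (suc i)) n))
    ≈⟨ solve 3 (λ a b c → a :* (b :+ c) := a :* b :+ a :* c) refl (y ^ d) (y ^ f 0) _ ⟩
  y ^ d ⊗ y ^ f 0 ⊕ y ^ d ⊗ powerSum y (applyUpTo (λ i → f (suc i)) n)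
    ≈⟨ +-cong (trans (sym (^-homo-* y d (f 0))) (^-cong-≡ y (h 0 (s≤s z≤n))))
              (⊗-powerSum y d _ _ n λ i i<n → h (suc i) (s≤s i<n)) ⟩
  y ^ g 0 ⊕ powerSum y (applyUpTo (λ i → g (suc i)) n)
    ∎
  where open ≋-Reasoning

powerSum-geometric : ∀ y c n → powerSum y (applyUpTo (c *_) n) ≋ geometric (y ^ c) n
powerSum-geometric y c zero = refl
powerSum-geometric y c (suc n) = +-cong (^-cong-≡ y (ℕ.*-zeroʳ c))
  (trans (sym (⊗-powerSum y c (c *_) _ n λ i _ → ≡.sym (ℕ.*-suc c i))) (*ˡ (powerSum-geometric y c n)))

-- All occurrences are removed; on a list without repetitions this takes away a single power.
delete : ℕ → List ℕ → List ℕ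
delete c = filter (λ e → ¬? (e ℕ.≟ c))

powerSum-delete : ∀ y {c es} → Unique es → c ∈ es → powerSum y es ≋ y ^ c ⊕ powerSum y (delete c es)
powerSum-delete y {c} {e ∷ es} (e∉es ∷ u) c∈ with e ℕ.≟ c
powerSum-delete y {c} {e ∷ es} (e∉es ∷ u) c∈ | yes ≡.refl =
  +ˡ (reflexive (≡.cong (powerSum y) (≡.sym (≡.trans
    (List.filter-reject (λ e → ¬? (e ℕ.≟ c)) {xs = es} (λ e≢e → e≢e ≡.refl))
    (List.filter-all (λ e → ¬? (e ℕ.≟ c)) (All.map (λ c≢x x≡c → c≢x (≡.sym x≡c)) e∉es))))))
powerSum-delete y {c} {e ∷ es} (e∉es ∷ u) (here c≡e) | no e≢c = ⊥-elim (e≢c (≡.sym c≡e))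
powerSum-delete y {c} {e ∷ es} (e∉es ∷ u) (there c∈) | no e≢c = begin
  y ^ e ⊕ powerSum y es                          ≈⟨ +ˡ (powerSum-delete y u c∈) ⟩
  y ^ e ⊕ (y ^ c ⊕ powerSum y (delete c es))     ≈⟨ solve 3 (λ a b s → a :+ (b :+ s) := b :+ (a :+ s)) refl (y ^ e) (y ^ c) _ ⟩
  y ^ c ⊕ (y ^ e ⊕ powerSum y (delete c es))     ≡⟨ ≡.cong (λ l → y ^ c ⊕ powerSum y l) (List.filter-accept (λ e → ¬? (e ℕ.≟ c)) {xs = es} e≢c) ⟨
  y ^ c ⊕ powerSum y (delete c (e ∷ es))         ∎
  where open ≋-Reasoning

-- From sets of exponents to 0/1 coefficients

occurs : List ℕ → ℕ → Bool
occurs es i = any (ℕ._≡ᵇ i) es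

occurs⇒∈ : ∀ es i → T (occurs es i) → i ∈ es
occurs⇒∈ (e ∷ es) i t with e ℕ.≡ᵇ i in eq
... | true = here (≡.sym (ℕ.≡ᵇ⇒≡ e i (≡.subst T (≡.sym eq) tt)))
... | false = there (occurs⇒∈ es i t)

∈⇒occurs : ∀ {es i} → i ∈ es → occurs es i ≡ true
∈⇒occurs {e ∷ es} (here ≡.refl) with e ℕ.≡ᵇ e | ℕ.≡⇒≡ᵇ e e ≡.refl
... | true | _ = ≡.refl
∈⇒occurs {e ∷ es} {i} (there i∈) rewrite ∈⇒occurs i∈ with e ℕ.≡ᵇ i
... | true = ≡.refl
... | false = ≡.refl

-- Since e is not in `es`, both indicators cannot be 1 at once, so the disjunction of the bits is
-- their sum.
bit-occurs-∷ : ∀ e es → e ∉ es → ∀ i → bit (occurs (e ∷ es) i) ≡ bit (e ℕ.≡ᵇ i) ℤ.+ bit (occurs es i)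
bit-occurs-∷ e es e∉ i with e ℕ.≡ᵇ i in eq
... | false = ≡.sym (ℤ.+-identityˡ _)
... | true with occurs es i in eq′
...   | false = ≡.refl
...   | true with ≡.refl ← ℕ.≡ᵇ⇒≡ e i (≡.subst T (≡.sym eq) tt) =
        ⊥-elim (e∉ (occurs⇒∈ es i (≡.subst T (≡.sym eq′) tt)))

applyUpTo-cong-≋ : ∀ (f g : ℕ → ℤ) n → (∀ i → f i ≡ g i) → applyUpTo f n ≋ applyUpTo g n
applyUpTo-cong-≋ f g zero h = refl
applyUpTo-cong-≋ f g (suc n) h = ∷-cong (h 0) (applyUpTo-cong-≋ _ _ n λ i → h (suc i))

applyUpTo-+ : ∀ (f g : ℕ → ℤ) n → applyUpTo (λ i → f i ℤ.+ g i) n ≋ applyUpTo f n ⊕ applyUpTo g n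
applyUpTo-+ f g n = trans (pointwise f g n) (reflexive (≡.sym (⊕≡+ₚ (applyUpTo f n) (applyUpTo g n))))
  where
  pointwise : ∀ f g n → applyUpTo (λ i → f i ℤ.+ g i) n ≋ applyUpTo f n +ₚ applyUpTo g n
  pointwise f g zero = refl
  pointwise f g (suc n) = ∷-cong ≡.refl (pointwise _ _ n)

applyUpTo-0 : ∀ n → applyUpTo (λ _ → + 0) n ≋ []
applyUpTo-0 zero = refl
applyUpTo-0 (suc n) = trans (∷-cong ≡.refl (applyUpTo-0 n)) 0∷[]≋[]

applyUpTo-indicator : ∀ e n → e < n → applyUpTo (λ i → bit (e ℕ.≡ᵇ i)) n ≋ X ^ e
applyUpTo-indicator zero (suc n) _ = trans (∷-cong ≡.refl (applyUpTo-0 n)) (reflexive (≡.sym (const≡∷[] (+ 1))))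
applyUpTo-indicator (suc e) (suc n) (s≤s e<n) =
  trans (sym (X-* _)) (*ˡ (applyUpTo-indicator e n e<n))

powerSum-digits : ∀ es n → Unique es → All (_< n) es → applyUpTo (λ i → bit (occurs es i)) n ≋ powerSum X es
powerSum-digits [] n _ _ = applyUpTo-0 n
powerSum-digits (e ∷ es) n (e∉es ∷ u) (e<n ∷ es<n) = begin
  applyUpTo (λ i → bit (occurs (e ∷ es) i)) n
    ≈⟨ applyUpTo-cong-≋ _ _ n (bit-occurs-∷ e es λ e∈ → All.lookup e∉es e∈ ≡.refl) ⟩
  applyUpTo (λ i → bit (e ℕ.≡ᵇ i) ℤ.+ bit (occurs es i)) n
    ≈⟨ applyUpTo-+ _ _ n ⟩
  applyUpTo (λ i → bit (e ℕ.≡ᵇ i)) n ⊕ applyUpTo (λ i → bit (occurs es i)) n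
    ≈⟨ +-cong (applyUpTo-indicator e n e<n) (powerSum-digits es n u es<n) ⟩
  X ^ e ⊕ powerSum X es
    ∎
  where open ≋-Reasoning

digits : List ℕ → ℕ → List Bool
digits es m = applyUpTo (λ i → occurs es (suc i)) m

-- The digits cover positions 1 to m only; the exponent 0 supplies the fixed constant term -1.
polyA-digits : ∀ es m → Unique es → All (_< suc m) es → 0 ∈ es →
  polyA (digits es m) ≋ X ^ suc m ⊕ ⊖ powerSum X es
polyA-digits es m u es< 0∈ = begin
  -[1+ 0 ] ∷ (map (λ b → ℤ.- bit b) (digits es m) ∷ʳ + 1)
    ≡⟨ ≡.cong (λ l → (-[1+ 0 ] ∷ l) ∷ʳ + 1) (List.map-applyUpTo _ _ m) ⟩
  (-[1+ 0 ] ∷ applyUpTo (λ i → ℤ.- bit (occurs es (suc i))) m) ∷ʳ + 1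
    ≡⟨ ≡.cong (λ b → (ℤ.- bit b ∷ applyUpTo (λ i → ℤ.- bit (occurs es (suc i))) m) ∷ʳ + 1) (∈⇒occurs 0∈) ⟨
  applyUpTo (λ i → ℤ.- bit (occurs es i)) (suc m) ∷ʳ + 1
    ≡⟨ ≡.cong (_∷ʳ + 1) (List.map-applyUpTo (λ i → bit (occurs es i)) (λ a → ℤ.- a) (suc m)) ⟨
  (-ₚ applyUpTo (λ i → bit (occurs es i)) (suc m)) ∷ʳ + 1
    ≈⟨ ∷ʳ-≋ (-ₚ applyUpTo (λ i → bit (occurs es i)) (suc m)) (+ 1) ⟩
  (-ₚ applyUpTo (λ i → bit (occurs es i)) (suc m)) ⊕ 1# ⊗ X ^ length (-ₚ applyUpTo (λ i → bit (occurs es i)) (suc m))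
    ≈⟨ +-cong (trans (reflexive (≡.sym (⊖≡-ₚ _))) (-‿cong (powerSum-digits es (suc m) u es<)))
         (trans (*-identityˡ _) (^-cong-≡ X (≡.trans (List.length-map (λ a → ℤ.- a) (applyUpTo (λ i → bit (occurs es i)) (suc m))) (List.length-applyUpTo (λ i → bit (occurs es i)) (suc m))))) ⟩
  ⊖ powerSum X es ⊕ X ^ suc m
    ≈⟨ solve 2 (λ x y → :- x :+ y := y :+ :- x) refl (powerSum X es) (X ^ suc m) ⟩
  X ^ suc m ⊕ ⊖ powerSum X es
    ∎
  where open ≋-Reasoning

powerSum-scale : ∀ w es → powerSum (X ^ w) es ≋ powerSum X (map (w *_) es)
powerSum-scale w [] = refl
powerSum-scale w (e ∷ es) = +-cong (^-assocʳ X w e) (powerSum-scale w es)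

opaque
  unfolding cyclotomic

  cyclotomic∣⇒Φ∣ₚ : ∀ n {p q} → cyclotomic n ∣ p → p ≋ q → Φ n ∣ₚ q
  cyclotomic∣⇒Φ∣ₚ n (s , e) f = s , coeff-≡ (trans (reflexive (≡.sym (⊗≡*ₚ (Φ n) s))) (trans e f))

module _ (n w m : ℕ) (es : List ℕ) where
  open Modulo (cyclotomic n)

  -- In terms of X each exponent is multiplied by w; as w is positive, the exponents stay distinct
  -- and below the degree w m.
  powerSum≈⇒InA : 1 ≤ w * m → w * m < n → 1 ≤ w → Unique es → All (_< m) es → 0 ∈ es →
    powerSum (X ^ w) es ≈ (X ^ w) ^ m → ∃ λ as → InA n as × degA as ≡ w * m
  powerSum≈⇒InA 1≤wm wm<n 1≤w u es<m 0∈ e with w * m in eq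
  ... | suc M = digits (map (w *_) es) M , (≡.subst (_< n) (≡.sym deg) wm<n ,
          cyclotomic∣⇒Φ∣ₚ n (divides-difference (≈-sym e)) (trans (+-cong (trans (^-assocʳ X w m) (^-cong-≡ X eq)) (-‿cong (powerSum-scale w es)))
            (sym (polyA-digits (map (w *_) es) M
              (Unique.map⁺ (λ {i} {j} → ℕ.*-cancelˡ-≡ i j w ⦃ ℕ.>-nonZero 1≤w ⦄) u)
              (All.map⁺ (All.map (λ {i} i<m → ≡.subst (w * i ℕ.<_) eq (ℕ.*-monoʳ-< w ⦃ ℕ.>-nonZero 1≤w ⦄ i<m)) es<m))
              (≡.subst (_∈ map (w *_) es) (ℕ.*-zeroʳ w) (∈-map⁺ (w *_) 0∈)))))) , deg
    where
    deg : degA (digits (map (w *_) es) M) ≡ suc M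
    deg = ≡.cong suc (List.length-applyUpTo _ M)

-- Deleting exponents, and the basic congruences

module _ (n w h c : ℕ) where
  open Modulo (cyclotomic n)

  -- Without y^c the zero sum becomes -y^c, which is y^(c + h) because y^h is -1; this is the
  -- leading term.
  delete-InA : (es : List ℕ) → Unique es → c ∈ es → 0 ∈ es → 0 ≢ c → All (_< c + h) es →
    (X ^ w) ^ h ≈ ⊖ 1# → powerSum (X ^ w) es ≈ [] → 1 ≤ w → w * (c + h) < n →
    ∃ λ as → InA n as × degA as ≡ w * (c + h)
  delete-InA es u c∈ 0∈ 0≢c es< half zero-sum 1≤w deg< =
    powerSum≈⇒InA n w (c + h) (delete c es)
      (ℕ.*-mono-≤ 1≤w (ℕ.≤-trans (ℕ.n≢0⇒n>0 (λ c≡0 → 0≢c (≡.sym c≡0))) (ℕ.m≤m+n c h))) deg< 1≤w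
      (Unique.filter⁺ (λ e → ¬? (e ℕ.≟ c)) u) (All.filter⁺ (λ e → ¬? (e ℕ.≟ c)) es<)
      (∈-filter⁺ (λ e → ¬? (e ℕ.≟ c)) 0∈ 0≢c) (begin
        S                                  ≈⟨ ≋⇒≈ (solve 2 (λ x s → s := :- x :+ (x :+ s)) refl (y ^ c) S) ⟩
        ⊖ (y ^ c) ⊕ (y ^ c ⊕ S)            ≈⟨ ⊕-cong (≋⇒≈ refl) (≋⇒≈ (sym (powerSum-delete y u c∈))) ⟩
        ⊖ (y ^ c) ⊕ powerSum y es          ≈⟨ ⊕-cong (≋⇒≈ refl) zero-sum ⟩
        ⊖ (y ^ c) ⊕ []                     ≈⟨ ≋⇒≈ (trans (+-identityʳ _) (solve 1 (λ x → :- x := x :* :- con (+ 1)) refl (y ^ c))) ⟩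
        y ^ c ⊗ ⊖ 1#                       ≈⟨ ⊗-congˡ (y ^ c) half ⟨
        y ^ c ⊗ y ^ h                      ≈⟨ ≋⇒≈ (^-homo-* y c h) ⟨
        y ^ (c + h)                      ∎)
    where
    open ≈-Reasoning
    y S : Poly
    y = X ^ w
    S = powerSum y (delete c es)

module _ (P y : Poly) (h : ℕ) where
  open Modulo P
  open ≈-Reasoning

  -- y^e is a unit modulo P: its product with y^(h - e) is y^h, that is, -1.
  cancel-^ : y ^ h ≈ ⊖ 1# → ∀ {e p q} → e ≤ h → y ^ e ⊗ p ≈ y ^ e ⊗ q → p ≈ q
  cancel-^ half {e} {p} {q} e≤h eq = begin
    p                                  ≈⟨ neg p ⟨
    ⊖ 1# ⊗ (y ^ h ⊗ p)                 ≈⟨ ⊗-congˡ (⊖ 1#) (≋⇒≈ (split p)) ⟩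
    ⊖ 1# ⊗ (y ^ (h ∸ e) ⊗ (y ^ e ⊗ p)) ≈⟨ ⊗-congˡ (⊖ 1#) (⊗-congˡ (y ^ (h ∸ e)) eq) ⟩
    ⊖ 1# ⊗ (y ^ (h ∸ e) ⊗ (y ^ e ⊗ q)) ≈⟨ ⊗-congˡ (⊖ 1#) (≋⇒≈ (split q)) ⟨
    ⊖ 1# ⊗ (y ^ h ⊗ q)                 ≈⟨ neg q ⟩
    q                                  ∎
    where
    split : ∀ p → y ^ h ⊗ p ≋ y ^ (h ∸ e) ⊗ (y ^ e ⊗ p)
    split p = trans (*ʳ (trans (^-cong-≡ y (≡.sym (ℕ.m∸n+n≡m e≤h))) (^-homo-* y (h ∸ e) e))) (*-assoc _ _ p)
    neg : ∀ p → ⊖ 1# ⊗ (y ^ h ⊗ p) ≈ p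
    neg p = begin
      ⊖ 1# ⊗ (y ^ h ⊗ p)   ≈⟨ ≋⇒≈ (solve 2 (λ z p → :- con (+ 1) :* (z :* p) := :- p :* z) refl (y ^ h) p) ⟩
      ⊖ p ⊗ y ^ h          ≈⟨ ⊗-congˡ (⊖ p) half ⟩
      ⊖ p ⊗ ⊖ 1#           ≈⟨ ≋⇒≈ (solve 1 (λ p → :- p :* :- con (+ 1) := p) refl p) ⟩
      p                    ∎

module _ (n w : ℕ) (1≤w : 1 ≤ w) where
  open Modulo (cyclotomic n)

  geometric≈[] : ∀ c k → 1 ≤ c → 2 ≤ k → n ≡ w * c * k → geometric ((X ^ w) ^ c) k ≈ []
  geometric≈[] c k 1≤c 2≤k eq = ≈-trans (≋⇒≈ (geometric-cong (^-assocʳ X w c) k))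
    (∣⇒≈[] (≡.subst (λ l → cyclotomic l ∣ geometric (X ^ (w * c)) k) (≡.sym eq)
      (cyclotomic∣geometric (w * c) k (ℕ.*-mono-≤ 1≤w 1≤c) 2≤k)))
    where
    geometric-cong : ∀ {y z} → y ≋ z → ∀ k → geometric y k ≋ geometric z k
    geometric-cong e zero = refl
    geometric-cong e (suc k) = +ˡ (*-cong e (geometric-cong e k))

  -- The geometric sum with two terms, 1 + y^h, vanishes.
  half-power≈-1 : ∀ h → 1 ≤ h → n ≡ w * h * 2 → (X ^ w) ^ h ≈ ⊖ 1#
  half-power≈-1 h 1≤h eq = begin
    z                                     ≈⟨ ≋⇒≈ (solve 1 (λ z → z := :- con (+ 1) :+ (con (+ 1) :+ z :* (con (+ 1) :+ z :* con (+ 0)))) refl z) ⟩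
    ⊖ 1# ⊕ (1# ⊕ z ⊗ (1# ⊕ z ⊗ const (+ 0))) ≈⟨ ≋⇒≈ (+ˡ (+ˡ (*ˡ (+ˡ (*ˡ const-0))))) ⟩
    ⊖ 1# ⊕ geometric z 2                  ≈⟨ ⊕-cong (≋⇒≈ refl) (geometric≈[] h 2 1≤h (s≤s (s≤s z≤n)) eq) ⟩
    ⊖ 1# ⊕ []                             ≈⟨ ≋⇒≈ (+-identityʳ (⊖ 1#)) ⟩
    ⊖ 1#                                  ∎
    where
    open ≈-Reasoning
    z : Poly
    z = (X ^ w) ^ h

module _ (n w h c₁ c₂ : ℕ) where
  open Modulo (cyclotomic n)

  -- Deleting c₁ makes the remaining sum vanish; deleting c₂ then produces the leading term.
  delete₂-InA : (es : List ℕ) → Unique es → c₁ ∈ es → c₂ ∈ es → c₂ ≢ c₁ → 0 ∈ es → 0 ≢ c₁ → 0 ≢ c₂ →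
    All (_< c₂ + h) es → (X ^ w) ^ h ≈ ⊖ 1# → powerSum (X ^ w) es ≈ (X ^ w) ^ c₁ →
    1 ≤ w → w * (c₂ + h) < n → ∃ λ as → InA n as × degA as ≡ w * (c₂ + h)
  delete₂-InA es u c₁∈ c₂∈ c₂≢c₁ 0∈ 0≢c₁ 0≢c₂ es< half sum≈ =
    delete-InA n w h c₂ (delete c₁ es) (Unique.filter⁺ ≢c₁? u) (∈-filter⁺ ≢c₁? c₂∈ c₂≢c₁) (∈-filter⁺ ≢c₁? 0∈ 0≢c₁) 0≢c₂
      (All.filter⁺ ≢c₁? es<) half (begin
        S                                  ≈⟨ ≋⇒≈ (solve 2 (λ x s → s := :- x :+ (x :+ s)) refl (y ^ c₁) S) ⟩
        ⊖ (y ^ c₁) ⊕ (y ^ c₁ ⊕ S)          ≈⟨ ≋⇒≈ (+ˡ (sym (powerSum-delete y u c₁∈))) ⟩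
        ⊖ (y ^ c₁) ⊕ powerSum y es         ≈⟨ ⊕-cong (≋⇒≈ refl) sum≈ ⟩
        ⊖ (y ^ c₁) ⊕ y ^ c₁                ≈⟨ ≋⇒≈ (trans (solve 1 (λ x → :- x :+ x := con (+ 0)) refl (y ^ c₁)) const-0) ⟩
        []                                 ∎)
    where
    open ≈-Reasoning
    ≢c₁? : Decidable (_≢ c₁)
    ≢c₁? e = ¬? (e ℕ.≟ c₁)
    y S : Poly
    y = X ^ w
    S = powerSum y (delete c₁ es)

degree-bound : ∀ {n w c h} → 1 ≤ w → n ≡ w * h * 2 → c < h → w * (c + h) < n
degree-bound {n} {w} {c} {h} 1≤w eq c<h = ≡.subst (w * (c + h) ℕ.<_) (≡.sym (≡.trans eq (lemma w h)))
  (ℕ.*-monoʳ-< w ⦃ ℕ.>-nonZero 1≤w ⦄ (ℕ.+-monoˡ-< h c<h))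
  where
  lemma : ∀ w h → w * h * 2 ≡ w * (h + h)
  lemma = solve-∀

-- The three ranges of p₂

case₃ : ∀ n w a → 1 ≤ w → 1 ≤ a → n ≡ w * (1 + 2 * a) * 2 →
  ∃ λ as → InA n as × degA as ≡ w * (2 * a + (1 + 2 * a))
case₃ n w a 1≤w 1≤a eq = delete-InA n w p (2 * a) (applyUpTo (2 *_) p)
  (Unique.applyUpTo⁺₁ (2 *_) p λ {i} {j} i<j _ e → ℕ.<⇒≢ i<j (ℕ.*-cancelˡ-≡ i j 2 e))
  (∈-applyUpTo⁺ (2 *_) {a} (s≤s (ℕ.m≤m+n a _)))
  (here ≡.refl)
  (ℕ.<⇒≢ (ℕ.≤-trans 1≤a (ℕ.m≤m+n a _)))
  -- The largest exponent is 2 (p - 1) = 4a, one below the degree 4a + 1 = 2p - 1.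
  (All.applyUpTo⁺₁ (2 *_) p λ {i} i<p → ℕ.≤-<-trans (ℕ.*-monoʳ-≤ 2 (ℕ.≤-pred i<p)) (ℕ.≤-reflexive (double a)))
  (half-power≈-1 n w 1≤w p (s≤s z≤n) eq)
  (≈-trans (≋⇒≈ (powerSum-geometric (X ^ w) 2 p))
    (geometric≈[] n w 1≤w 2 p (s≤s z≤n) (s≤s (ℕ.≤-trans 1≤a (ℕ.m≤m+n a _))) (≡.trans eq (swap w p))))
  1≤w (degree-bound 1≤w eq (ℕ.n<1+n (2 * a)))
  where
  open Modulo (cyclotomic n)
  p : ℕ
  p = 1 + 2 * a
  double : ∀ a → suc (2 * (2 * a)) ≡ 2 * a + (1 + 2 * a)
  double = solve-∀
  swap : ∀ w p → w * p * 2 ≡ w * 2 * p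
  swap = solve-∀

module Case₁ (n w a b′ : ℕ) (1≤w : 1 ≤ w) (1≤a : 1 ≤ a) where
  b p q h c₁ c₂ : ℕ
  b = suc b′
  p = 1 + 2 * a
  q = 1 + 2 * b
  h = p * q
  -- As 2a = p - 1 and 2b = q - 1, these are c₁ = pq - q and c₂ = pq - p - q.
  c₁ = 2 * q * a
  c₂ = 2 * p * b ∸ q
  y : Poly
  y = X ^ w
  multiples-q shifted-multiples-p exponents : List ℕ
  multiples-q = applyUpTo (2 * q *_) p
  -- The index j stands for the multiplier j + 1, which runs from 1 to q - 1 = 2b.
  shifted-multiples-p = applyUpTo (λ j → 2 * p * suc j ∸ q) (2 * b)
  exponents = multiples-q ++ shifted-multiples-p

  module _ (n≡ : n ≡ w * h * 2) (p<q : p < q) (q<2p : q < 2 * p) where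
    open Modulo (cyclotomic n)

    1<p : 1 < p
    1<p = s≤s (ℕ.≤-trans 1≤a (ℕ.m≤m+n a _))

    half : y ^ h ≈ ⊖ 1#
    half = half-power≈-1 n w 1≤w h (s≤s z≤n) n≡

    q≤2p* : ∀ j → q ≤ 2 * p * suc j
    q≤2p* j = ℕ.≤-trans (ℕ.<⇒≤ q<2p) (ℕ.m≤m*n (2 * p) (suc j))

    q≤h : q ≤ h
    q≤h = ℕ.m≤n*m q p

    sum-multiples-q : powerSum y multiples-q ≈ []
    sum-multiples-q = ≈-trans (≋⇒≈ (powerSum-geometric y (2 * q) p))
      (geometric≈[] n w 1≤w (2 * q) p (s≤s z≤n) 1<p (≡.trans n≡ (lemma w p q)))
      where
      lemma : ∀ w p q → w * (p * q) * 2 ≡ w * (2 * q) * p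
      lemma = solve-∀

    -- After multiplication by y^q the sum is a full progression of step 2p without its first term
    -- 1. It is therefore -1 = y^h = y^(q + c₁), and y^q can be cancelled.
    sum-shifted-multiples-p : powerSum y shifted-multiples-p ≈ y ^ c₁
    sum-shifted-multiples-p = cancel-^ (cyclotomic n) y h half q≤h (begin
      y ^ q ⊗ powerSum y shifted-multiples-p
        ≈⟨ ≋⇒≈ (⊗-powerSum y q _ (λ j → 2 * p * suc j) (2 * b) λ j _ → ℕ.m+[n∸m]≡n (q≤2p* j)) ⟩
      S
        ≈⟨ ≋⇒≈ (solve 1 (λ s → s := :- con (+ 1) :+ (con (+ 1) :+ s)) refl S) ⟩
      ⊖ 1# ⊕ (1# ⊕ S)
        ≈⟨ ≋⇒≈ (+ˡ (+ʳ (^-cong-≡ y (≡.sym (ℕ.*-zeroʳ (2 * p)))))) ⟩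
      ⊖ 1# ⊕ powerSum y (applyUpTo (2 * p *_) q)
        ≈⟨ ⊕-cong (≋⇒≈ refl) (≋⇒≈ (powerSum-geometric y (2 * p) q)) ⟩
      ⊖ 1# ⊕ geometric (y ^ (2 * p)) q
        ≈⟨ ⊕-cong (≋⇒≈ refl) (geometric≈[] n w 1≤w (2 * p) q (s≤s z≤n) (s≤s (s≤s z≤n)) (≡.trans n≡ (lemma w p q))) ⟩
      ⊖ 1# ⊕ []
        ≈⟨ ≋⇒≈ (+-identityʳ (⊖ 1#)) ⟩
      ⊖ 1#
        ≈⟨ half ⟨
      y ^ h
        ≈⟨ ≋⇒≈ (^-cong-≡ y (expand a q)) ⟩
      y ^ (q + c₁)
        ≈⟨ ≋⇒≈ (^-homo-* y q c₁) ⟩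
      y ^ q ⊗ y ^ c₁
        ∎)
      where
      open ≈-Reasoning
      S : Poly
      S = powerSum y (applyUpTo (λ j → 2 * p * suc j) (2 * b))
      lemma : ∀ w p q → w * (p * q) * 2 ≡ w * (2 * p) * q
      lemma = solve-∀
      expand : ∀ a q → (1 + 2 * a) * q ≡ q + 2 * q * a
      expand = solve-∀

    q+c₂≡2pb : q + c₂ ≡ 2 * p * b
    q+c₂≡2pb = ℕ.m+[n∸m]≡n (q≤2p* b′)

    -- q + c₂ = 2pb is even, while q + c₁ = q (1 + 2a) is odd.
    c₂≢c₁ : c₂ ≢ c₁
    c₂≢c₁ e = ℕ.even≢odd (p * b) (b + q * a) (≡.trans (≡.sym (ℕ.*-assoc 2 p b))
      (≡.trans (≡.sym q+c₂≡2pb) (≡.trans (≡.cong (q ℕ.+_) e) (parity a b))))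
      where
      parity : ∀ a b → (1 + 2 * b) + 2 * (1 + 2 * b) * a ≡ suc (2 * (b + (1 + 2 * b) * a))
      parity = solve-∀

    0≢c₁ : 0 ≢ c₁
    0≢c₁ = ℕ.<⇒≢ (ℕ.*-mono-≤ {1} {2 * q} (s≤s z≤n) 1≤a)

    0≢c₂ : 0 ≢ c₂
    0≢c₂ e = ℕ.<⇒≢ (ℕ.<-≤-trans q<2p (ℕ.m≤m*n (2 * p) b)) (≡.trans (≡.sym (ℕ.+-identityʳ q)) (≡.trans (≡.cong (q ℕ.+_) e) q+c₂≡2pb))

    c₁∈ : c₁ ∈ exponents
    c₁∈ = ∈-++⁺ˡ (∈-applyUpTo⁺ (2 * q *_) {a} (s≤s (ℕ.m≤m+n a _)))

    c₂∈ : c₂ ∈ exponents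
    c₂∈ = ∈-++⁺ʳ multiples-q (∈-applyUpTo⁺ (λ j → 2 * p * suc j ∸ q) {b′} (s≤s (ℕ.m≤m+n b′ _)))

    unique : Unique exponents
    unique = Unique.++⁺
      (Unique.applyUpTo⁺₁ (2 * q *_) p λ {i} {j} i<j _ e → ℕ.<⇒≢ i<j (ℕ.*-cancelˡ-≡ i j (2 * q) e))
      (Unique.applyUpTo⁺₁ (λ j → 2 * p * suc j ∸ q) (2 * b) λ {i} {j} i<j _ e →
        ℕ.<⇒≢ i<j (ℕ.suc-injective (ℕ.*-cancelˡ-≡ (suc i) (suc j) (2 * p) (ℕ.∸-cancelʳ-≡ (q≤2p* i) (q≤2p* j) e))))
      disjoint
      where
      parity : ∀ b i → (1 + 2 * b) + 2 * (1 + 2 * b) * i ≡ suc (2 * (b + (1 + 2 * b) * i))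
      parity = solve-∀
      disjoint : Disjoint multiples-q shifted-multiples-p
      disjoint (v∈₁ , v∈₂)
        with i , _ , e₁ ← ∈-applyUpTo⁻ (2 * q *_) v∈₁
        with j , _ , e₂ ← ∈-applyUpTo⁻ (λ j → 2 * p * suc j ∸ q) v∈₂
        = ℕ.even≢odd (p * suc j) (b + q * i) (≡.trans (≡.sym (ℕ.*-assoc 2 p (suc j)))
            (≡.trans (≡.sym (ℕ.m+[n∸m]≡n (q≤2p* j))) (≡.trans (≡.cong (q ℕ.+_) (≡.trans (≡.sym e₂) e₁)) (parity b i))))

    degree : c₂ + h + (q + p) ≡ 2 * h
    degree = ≡.trans (rearrange c₂ h q p) (≡.trans (≡.cong (λ x → x + p + h) q+c₂≡2pb) (expand p b))
      where
      rearrange : ∀ c h q p → c + h + (q + p) ≡ q + c + p + h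
      rearrange = solve-∀
      expand : ∀ p b → 2 * p * b + p + p * (1 + 2 * b) ≡ 2 * (p * (1 + 2 * b))
      expand = solve-∀

    -- Adding p + q to both sides turns the degree into 2pq and avoids subtraction.
    below : ∀ {e} → e + (q + p) < 2 * h → e < c₂ + h
    below {e} l = ℕ.+-cancelʳ-< (q + p) e (c₂ + h) (ℕ.<-≤-trans l (ℕ.≤-reflexive (≡.sym degree)))

    bounded : All (_< c₂ + h) exponents
    bounded = All.++⁺
      -- The largest term is 2q (p - 1) = 2pq - 2q, and p < q puts it below 2pq - p - q.
      (All.applyUpTo⁺₁ (2 * q *_) p λ {i} i<p → below (ℕ.≤-<-trans
        (ℕ.+-monoˡ-≤ (q + p) (ℕ.*-monoʳ-≤ (2 * q) (ℕ.≤-pred i<p)))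
        (ℕ.<-≤-trans (ℕ.+-monoʳ-< (2 * q * (2 * a)) (ℕ.+-monoʳ-< q p<q)) (ℕ.≤-reflexive (expand₁ a q)))))
      (All.applyUpTo⁺₁ (λ j → 2 * p * suc j ∸ q) (2 * b) λ {j} j<2b → below (begin-strict
        2 * p * suc j ∸ q + (q + p)    ≡⟨ ℕ.+-assoc (2 * p * suc j ∸ q) q p ⟨
        2 * p * suc j ∸ q + q + p      ≡⟨ ≡.cong (_+ p) (ℕ.m∸n+n≡m (q≤2p* j)) ⟩
        2 * p * suc j + p                ≤⟨ ℕ.+-monoˡ-≤ p (ℕ.*-monoʳ-≤ (2 * p) j<2b) ⟩
        2 * p * (2 * b) + p            <⟨ ℕ.+-monoʳ-< (2 * p * (2 * b)) (ℕ.m<m+n p (s≤s z≤n)) ⟩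
        2 * p * (2 * b) + (p + p)    ≡⟨ expand₂ p b ⟩
        2 * h                                ∎))
      where
      open ℕ.≤-Reasoning
      expand₁ : ∀ a q → 2 * q * (2 * a) + (q + q) ≡ 2 * ((1 + 2 * a) * q)
      expand₁ = solve-∀
      expand₂ : ∀ p b → 2 * p * (2 * b) + (p + p) ≡ 2 * (p * (1 + 2 * b))
      expand₂ = solve-∀

    sum-exponents : powerSum y exponents ≈ y ^ c₁
    sum-exponents = ≈-trans (≋⇒≈ (powerSum-++ y multiples-q shifted-multiples-p))
      (≈-trans (⊕-cong sum-multiples-q sum-shifted-multiples-p) (≋⇒≈ (+-identityˡ (y ^ c₁))))

    c₂<h : c₂ < h
    c₂<h = ℕ.+-cancelʳ-< h c₂ h (ℕ.<-≤-trans (ℕ.m<m+n (c₂ + h) (s≤s z≤n)) (ℕ.≤-reflexive (≡.trans degree (≡.cong (h ℕ.+_) (ℕ.+-identityʳ h)))))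

    solution : ∃ λ as → InA n as × degA as ≡ w * (c₂ + h)
    solution = delete₂-InA n w h c₁ c₂ exponents unique c₁∈ c₂∈ c₂≢c₁ (here (≡.sym (ℕ.*-zeroʳ (2 * q)))) 0≢c₁ 0≢c₂
      bounded half sum-exponents 1≤w (degree-bound 1≤w n≡ c₂<h)

module Case₂ (n w a b′ : ℕ) (1≤w : 1 ≤ w) (1≤a : 1 ≤ a) where
  b p q h c₁ c₂ : ℕ
  b = suc b′
  p = 1 + 2 * a
  q = 1 + 2 * b
  h = p * q
  -- This is pq - 2p, in the form of the entry of the second progression at i = a. Since 2b′ = q -
  -- 3, c₂ is pq - 3p.
  c₁ = q * (1 + 2 * a) ∸ 2 * p
  c₂ = 2 * p * b′
  y : Poly
  y = X ^ w
  multiples-p shifted-multiples-q exponents : List ℕ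
  -- Only q - 1 = 2b terms: the last term 2p (q - 1) of the full progression is left out.
  multiples-p = applyUpTo (2 * p *_) (2 * b)
  shifted-multiples-q = applyUpTo (λ i → q * (1 + 2 * i) ∸ 2 * p) p
  exponents = multiples-p ++ shifted-multiples-q

  module _ (n≡ : n ≡ w * h * 2) (2p<q : 2 * p < q) where
    open Modulo (cyclotomic n)

    1<p : 1 < p
    1<p = s≤s (ℕ.≤-trans 1≤a (ℕ.m≤m+n a _))

    p<q : p < q
    p<q = ℕ.≤-<-trans (ℕ.m≤m+n p _) 2p<q

    half : y ^ h ≈ ⊖ 1#
    half = half-power≈-1 n w 1≤w h (s≤s z≤n) n≡

    2p≤q* : ∀ i → 2 * p ≤ q * (1 + 2 * i)
    2p≤q* i = ℕ.≤-trans (ℕ.<⇒≤ 2p<q) (ℕ.m≤m*n q (1 + 2 * i))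

    2p≤h : 2 * p ≤ h
    2p≤h = ℕ.≤-trans (2p≤q* a) (ℕ.≤-reflexive (ℕ.*-comm q p))

    2p+c₁≡qp : 2 * p + c₁ ≡ q * p
    2p+c₁≡qp = ℕ.m+[n∸m]≡n (2p≤q* a)

    -- The missing last exponent is 2p (q - 1) = c₁ + h, so the sum is -y^(c₁ + h) = y^c₁.
    sum-multiples-p : powerSum y multiples-p ≈ y ^ c₁
    sum-multiples-p = begin
      -- The missing term z is added and taken away again; the factor -1 is then replaced by y^h.
      S                                      ≈⟨ ≋⇒≈ (solve 2 (λ s x → s := (s :+ (x :+ con (+ 0))) :+ x :* :- con (+ 1)) refl S z) ⟩
      (S ⊕ (z ⊕ const (+ 0))) ⊕ z ⊗ ⊖ 1#     ≈⟨ ⊕-cong (≋⇒≈ (trans (+ˡ (+ˡ const-0)) (sym snoc))) (⊗-congˡ z (≈-sym half)) ⟩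
      powerSum y (applyUpTo (2 * p *_) q) ⊕ z ⊗ y ^ h
                                             ≈⟨ ⊕-cong (≋⇒≈ (powerSum-geometric y (2 * p) q)) (≋⇒≈ refl) ⟩
      geometric (y ^ (2 * p)) q ⊕ z ⊗ y ^ h
                                             ≈⟨ ⊕-cong (geometric≈[] n w 1≤w (2 * p) q (s≤s z≤n) (s≤s (s≤s z≤n)) (≡.trans n≡ (lemma w p q))) (≋⇒≈ refl) ⟩
      [] ⊕ z ⊗ y ^ h                         ≈⟨ ≋⇒≈ (trans (+-identityˡ _) (*ʳ (trans (^-cong-≡ y last≡) (^-homo-* y c₁ h)))) ⟩
      y ^ c₁ ⊗ y ^ h ⊗ y ^ h                 ≈⟨ ⊗-congˡ (y ^ c₁ ⊗ y ^ h) half ⟩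
      y ^ c₁ ⊗ y ^ h ⊗ ⊖ 1#                  ≈⟨ ≋⇒≈ (solve 2 (λ x z → x :* z :* :- con (+ 1) := :- x :* z) refl (y ^ c₁) (y ^ h)) ⟩
      ⊖ (y ^ c₁) ⊗ y ^ h                     ≈⟨ ⊗-congˡ (⊖ (y ^ c₁)) half ⟩
      ⊖ (y ^ c₁) ⊗ ⊖ 1#                      ≈⟨ ≋⇒≈ (solve 1 (λ x → :- x :* :- con (+ 1) := x) refl (y ^ c₁)) ⟩
      y ^ c₁                                 ∎
      where
      open ≈-Reasoning
      S z : Poly
      S = powerSum y multiples-p
      z = y ^ (2 * p * (2 * b))
      snoc : powerSum y (applyUpTo (2 * p *_) q) ≋ S ⊕ (z ⊕ [])
      snoc = trans (reflexive (≡.cong (powerSum y) (≡.sym (List.applyUpTo-∷ʳ (2 * p *_) (2 * b)))))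
        (powerSum-++ y multiples-p _)
      lemma : ∀ w p q → w * (p * q) * 2 ≡ w * (2 * p) * q
      lemma = solve-∀
      last≡ : 2 * p * (2 * b) ≡ c₁ + h
      last≡ = ℕ.+-cancelˡ-≡ (2 * p) _ _ (≡.trans (double p b)
        (≡.trans (≡.cong (_+ h) (≡.sym 2p+c₁≡qp)) (ℕ.+-assoc (2 * p) c₁ h)))
        where
        double : ∀ p b → 2 * p + 2 * p * (2 * b) ≡ (1 + 2 * b) * p + p * (1 + 2 * b)
        double = solve-∀

    -- Multiplying by y^(2p) gives the exponents q + 2qi, that is, y^q times a full progression of
    -- step 2q.
    sum-shifted-multiples-q : powerSum y shifted-multiples-q ≈ []
    sum-shifted-multiples-q = cancel-^ (cyclotomic n) y h half 2p≤h (begin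
      y ^ (2 * p) ⊗ powerSum y shifted-multiples-q
        ≈⟨ ≋⇒≈ (⊗-powerSum y (2 * p) _ (λ i → q * (1 + 2 * i)) p λ i _ → ℕ.m+[n∸m]≡n (2p≤q* i)) ⟩
      powerSum y (applyUpTo (λ i → q * (1 + 2 * i)) p)
        ≈⟨ ≋⇒≈ (⊗-powerSum y q (2 * q *_) _ p λ i _ → odd-multiple q i) ⟨
      y ^ q ⊗ powerSum y (applyUpTo (2 * q *_) p)
        ≈⟨ ⊗-congˡ (y ^ q) (≈-trans (≋⇒≈ (powerSum-geometric y (2 * q) p))
             (geometric≈[] n w 1≤w (2 * q) p (s≤s z≤n) 1<p (≡.trans n≡ (lemma w p q)))) ⟩
      y ^ q ⊗ []
        ≈⟨ ≋⇒≈ (trans (zeroʳ (y ^ q)) (sym (zeroʳ (y ^ (2 * p))))) ⟩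
      y ^ (2 * p) ⊗ []
        ∎)
      where
      open ≈-Reasoning
      lemma : ∀ w p q → w * (p * q) * 2 ≡ w * (2 * q) * p
      lemma = solve-∀
      odd-multiple : ∀ q i → q + 2 * q * i ≡ q * (1 + 2 * i)
      odd-multiple = solve-∀

    -- Elements of the two progressions have different parities.
    distinct : ∀ i j → 2 * p * i ≢ q * (1 + 2 * j) ∸ 2 * p
    distinct i j e = ℕ.even≢odd (p + p * i) (b + q * j) (begin
      2 * (p + p * i)                                       ≡⟨ even p i ⟩
      2 * p + 2 * p * i                                   ≡⟨ ≡.cong (2 * p ℕ.+_) e ⟩
      2 * p + (q * (1 + 2 * j) ∸ 2 * p)               ≡⟨ ℕ.m+[n∸m]≡n (2p≤q* j) ⟩
      q * (1 + 2 * j)                                       ≡⟨ odd b j ⟩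
      suc (2 * (b + q * j))                                 ∎)
      where
      open ≡.≡-Reasoning
      even : ∀ p i → 2 * (p + p * i) ≡ 2 * p + 2 * p * i
      even = solve-∀
      odd : ∀ b j → (1 + 2 * b) * (1 + 2 * j) ≡ suc (2 * (b + (1 + 2 * b) * j))
      odd = solve-∀

    0≢c₁ : 0 ≢ c₁
    0≢c₁ e = ℕ.<⇒≢ (ℕ.<-≤-trans 2p<q (ℕ.m≤m*n q p))
      (≡.trans (≡.sym (ℕ.+-identityʳ (2 * p))) (≡.trans (≡.cong (2 * p ℕ.+_) e) 2p+c₁≡qp))

    -- With b′ = 0 one would have q = 3, which is at most p, against 2p < q.
    0≢c₂ : 0 ≢ c₂
    0≢c₂ e with ℕ.m*n≡0⇒m≡0∨n≡0 (2 * p) (≡.sym e)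
    ... | inj₂ b′≡0 = ℕ.<⇒≱ 2p<q (ℕ.≤-trans (ℕ.≤-reflexive (≡.cong (λ b′ → 1 + 2 * suc b′) b′≡0))
      (ℕ.≤-trans (s≤s (ℕ.*-monoʳ-≤ 2 1≤a)) (ℕ.m≤m+n p _)))

    c₁∈ : c₁ ∈ exponents
    c₁∈ = ∈-++⁺ʳ multiples-p (∈-applyUpTo⁺ (λ i → q * (1 + 2 * i) ∸ 2 * p) {a} (s≤s (ℕ.m≤m+n a _)))

    c₂∈ : c₂ ∈ exponents
    c₂∈ = ∈-++⁺ˡ (∈-applyUpTo⁺ (2 * p *_) {b′} (s≤s (ℕ.m≤m+n b′ _)))

    unique : Unique exponents
    unique = Unique.++⁺
      (Unique.applyUpTo⁺₁ (2 * p *_) (2 * b) λ {i} {j} i<j _ e → ℕ.<⇒≢ i<j (ℕ.*-cancelˡ-≡ i j (2 * p) e))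
      (Unique.applyUpTo⁺₁ (λ i → q * (1 + 2 * i) ∸ 2 * p) p λ {i} {j} i<j _ e →
        ℕ.<⇒≢ i<j (ℕ.*-cancelˡ-≡ i j 2 (ℕ.suc-injective (ℕ.*-cancelˡ-≡ (1 + 2 * i) (1 + 2 * j) q
          (ℕ.∸-cancelʳ-≡ (2p≤q* i) (2p≤q* j) e)))))
      disjoint
      where
      disjoint : Disjoint multiples-p shifted-multiples-q
      disjoint (v∈₁ , v∈₂)
        with i , _ , e₁ ← ∈-applyUpTo⁻ (2 * p *_) v∈₁
        with j , _ , e₂ ← ∈-applyUpTo⁻ (λ i → q * (1 + 2 * i) ∸ 2 * p) v∈₂
        = distinct i j (≡.trans (≡.sym e₁) e₂)

    degree : c₂ + h + (2 * p + p) ≡ 2 * h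
    degree = expand p b′
      where
      expand : ∀ p b′ → 2 * p * b′ + p * (1 + 2 * (1 + b′)) + (2 * p + p) ≡ 2 * (p * (1 + 2 * (1 + b′)))
      expand = solve-∀

    below : ∀ {e} → e + (2 * p + p) < 2 * h → e < c₂ + h
    below {e} l = ℕ.+-cancelʳ-< (2 * p + p) e (c₂ + h) (ℕ.<-≤-trans l (ℕ.≤-reflexive (≡.sym degree)))

    bounded : All (_< c₂ + h) exponents
    bounded = All.++⁺
      (All.applyUpTo⁺₁ (2 * p *_) (2 * b) λ {j} j<2b → below (begin-strict
        2 * p * j + (2 * p + p)      ≡⟨ expand₁ p j ⟩
        2 * p * suc j + p                ≤⟨ ℕ.+-monoˡ-≤ p (ℕ.*-monoʳ-≤ (2 * p) j<2b) ⟩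
        2 * p * (2 * b) + p            <⟨ ℕ.+-monoʳ-< (2 * p * (2 * b)) (ℕ.m<m+n p (s≤s z≤n)) ⟩
        2 * p * (2 * b) + (p + p)    ≡⟨ expand₂ p b ⟩
        2 * h                                ∎))
      (All.applyUpTo⁺₁ (λ i → q * (1 + 2 * i) ∸ 2 * p) p λ {i} i<p → below (begin-strict
        q * (1 + 2 * i) ∸ 2 * p + (2 * p + p)    ≡⟨ ℕ.+-assoc (q * (1 + 2 * i) ∸ 2 * p) (2 * p) p ⟨
        q * (1 + 2 * i) ∸ 2 * p + 2 * p + p      ≡⟨ ≡.cong (_+ p) (ℕ.m∸n+n≡m (2p≤q* i)) ⟩
        q * (1 + 2 * i) + p                            ≤⟨ ℕ.+-monoˡ-≤ p (ℕ.*-monoʳ-≤ q (s≤s (ℕ.*-monoʳ-≤ 2 (ℕ.≤-pred i<p)))) ⟩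
        -- The largest term before the shift is q (2p - 1) = 2pq - q, so p < q suffices.
        q * (1 + 2 * (2 * a)) + p                    <⟨ ℕ.+-monoʳ-< (q * (1 + 2 * (2 * a))) p<q ⟩
        q * (1 + 2 * (2 * a)) + q                    ≡⟨ expand₃ q a ⟩
        2 * h                                                ∎))
      where
      open ℕ.≤-Reasoning
      expand₁ : ∀ p j → 2 * p * j + (2 * p + p) ≡ 2 * p * (1 + j) + p
      expand₁ = solve-∀
      expand₂ : ∀ p b → 2 * p * (2 * b) + (p + p) ≡ 2 * (p * (1 + 2 * b))
      expand₂ = solve-∀
      expand₃ : ∀ q a → q * (1 + 2 * (2 * a)) + q ≡ 2 * ((1 + 2 * a) * q)
      expand₃ = solve-∀

    sum-exponents : powerSum y exponents ≈ y ^ c₁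
    sum-exponents = ≈-trans (≋⇒≈ (powerSum-++ y multiples-p shifted-multiples-q))
      (≈-trans (⊕-cong sum-multiples-p sum-shifted-multiples-q) (≋⇒≈ (+-identityʳ (y ^ c₁))))

    c₂<h : c₂ < h
    c₂<h = ℕ.+-cancelʳ-< h c₂ h (ℕ.<-≤-trans (ℕ.m<m+n (c₂ + h) (s≤s z≤n)) (ℕ.≤-reflexive (≡.trans degree (≡.cong (h ℕ.+_) (ℕ.+-identityʳ h)))))

    solution : ∃ λ as → InA n as × degA as ≡ w * (c₂ + h)
    solution = delete₂-InA n w h c₁ c₂ exponents unique c₁∈ c₂∈ (distinct b′ a) (here (≡.sym (ℕ.*-zeroʳ (2 * p)))) 0≢c₁ 0≢c₂
      bounded half sum-exponents 1≤w (degree-bound 1≤w n≡ c₂<h)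

-- The degree bounds for odd primes

odd-prime : ∀ {p} → Prime p → p % 2 ≡ 1 → ∃ λ a → p ≡ 1 + 2 * suc a
odd-prime {p} p-prime p-odd with p ℕ./ 2 | m≡m%n+[m/n]*n p 2
-- A zero quotient would make the odd number p equal to 1.
... | zero | eq rewrite p-odd = ⊥-elim (¬prime[1] (≡.subst Prime eq p-prime))
... | suc a | eq rewrite p-odd = a , ≡.trans eq (≡.cong suc (ℕ.*-comm (suc a) 2))

-- The bound with its denominator D cleared: u m is the degree, u (2h) the order n and V the amount
-- saved times D. The two sides are in fact equal.
degree-bound-≤ : ∀ u m v h D {d N V} → d ≡ u * m → m + v ≡ 2 * h → N ≡ u * (2 * h) → V ≡ u * v * D → d * D + V ≤ N * D
degree-bound-≤ u m v h D ≡.refl e ≡.refl ≡.refl =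
  ℕ.≤-reflexive (≡.trans (lemma u m v D) (≡.cong (λ x → u * x * D) e))
  where
  lemma : ∀ u m v D → u * m * D + u * v * D ≡ u * (m + v) * D
  lemma = solve-∀

-- p, q and n are variables here so that neither the products nor Φ unfold.
small-degree₁ : ∀ {n w p q a b} → p ≡ 1 + 2 * suc a → q ≡ 1 + 2 * suc b → 1 ≤ w → n ≡ w * (p * q) * 2 → p < q → q < 2 * p →
  ∃ λ as → InA n as × ∃ λ m → degA as ≡ w * m × m + (q + p) ≡ 2 * (p * q)
small-degree₁ {n} {w} {a = a} {b} ≡.refl ≡.refl 1≤w n≡ p<q q<2p =
  let as , inA , deg = Case₁.solution n w (suc a) b 1≤w (s≤s z≤n) n≡ p<q q<2p
  in as , inA , _ , deg , Case₁.degree n w (suc a) b 1≤w (s≤s z≤n) n≡ p<q q<2p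

small-degree₂ : ∀ {n w p q a b} → p ≡ 1 + 2 * suc a → q ≡ 1 + 2 * suc b → 1 ≤ w → n ≡ w * (p * q) * 2 → 2 * p < q →
  ∃ λ as → InA n as × ∃ λ m → degA as ≡ w * m × m + (2 * p + p) ≡ 2 * (p * q)
small-degree₂ {n} {w} {a = a} {b} ≡.refl ≡.refl 1≤w n≡ 2p<q =
  let as , inA , deg = Case₂.solution n w (suc a) b 1≤w (s≤s z≤n) n≡ 2p<q
  in as , inA , _ , deg , Case₂.degree n w (suc a) b 1≤w (s≤s z≤n) n≡ 2p<q

small-degree₃ : ∀ {n w p a} → p ≡ 1 + 2 * suc a → 1 ≤ w → n ≡ w * p * 2 →
  ∃ λ as → InA n as × ∃ λ m → degA as ≡ w * m × m + 1 ≡ 2 * p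
small-degree₃ {n} {w} {a = a} ≡.refl 1≤w n≡ =
  let as , inA , deg = case₃ n w (suc a) 1≤w (s≤s z≤n) n≡ in as , inA , _ , deg , degree a
  where
  degree : ∀ a → 2 * (1 + a) + (1 + 2 * (1 + a)) + 1 ≡ 2 * (1 + 2 * (1 + a))
  degree = solve-∀

theorem3p15 : (p₁ p₂ : ℕ) (ps : List ℕ) →
    All Prime (p₁ ∷ p₂ ∷ ps) →
    All (λ p → p % 2 ≡ 1) (p₁ ∷ p₂ ∷ ps) →
    Linked _<_ (p₁ ∷ p₂ ∷ ps) →
    ((p₂ < 2 * p₁) →
    ∃ λ as → InA (2 * product (p₁ ∷ p₂ ∷ ps)) as ×
    (degA as * (2 * p₁ * p₂) + 2 * product (p₁ ∷ p₂ ∷ ps) * (p₁ + p₂)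
    ≤ 2 * product (p₁ ∷ p₂ ∷ ps) * (2 * p₁ * p₂))) ×
    ((2 * p₁ < p₂) → (p₂ < 3 * p₁) →
    ∃ λ as → InA (2 * product (p₁ ∷ p₂ ∷ ps)) as ×
    (degA as * (2 * p₂) + 3 * (2 * product (p₁ ∷ p₂ ∷ ps))
    ≤ 2 * product (p₁ ∷ p₂ ∷ ps) * (2 * p₂))) ×
    ((3 * p₁ < p₂) →
    ∃ λ as → InA (2 * product (p₁ ∷ p₂ ∷ ps)) as ×
    (degA as * (2 * p₁) + 2 * product (p₁ ∷ p₂ ∷ ps)
    ≤ 2 * product (p₁ ∷ p₂ ∷ ps) * (2 * p₁)))
theorem3p15 p₁ p₂ ps (p₁-prime ∷ p₂-prime ∷ ps-prime) (p₁-odd ∷ p₂-odd ∷ _) (p₁<p₂ Linked.∷ _) =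
  (λ p₂<2p₁ →
    let as , inA , m , deg , degree = small-degree₁ p₁≡ p₂≡ 1≤w (n₁ p₁ p₂ w) p₁<p₂ p₂<2p₁
    in as , inA , degree-bound-≤ w m (p₂ + p₁) (p₁ * p₂) (2 * p₁ * p₂) deg degree (N₁ p₁ p₂ w) (v₁ p₁ p₂ w)) ,
  (λ 2p₁<p₂ _ →
    let as , inA , m , deg , degree = small-degree₂ p₁≡ p₂≡ 1≤w (n₁ p₁ p₂ w) 2p₁<p₂
    in as , inA , degree-bound-≤ w m (2 * p₁ + p₁) (p₁ * p₂) (2 * p₂) deg degree (N₁ p₁ p₂ w) (v₂ p₁ p₂ w)) ,
  (λ _ →
    -- Here p₂ is absorbed into the scaling exponent, so y is x^(p₂ w) and y^p₁ is -1.
    let as , inA , m , deg , degree = small-degree₃ p₁≡ (ℕ.*-mono-≤ 1≤p₂ 1≤w) (n₃ p₁ p₂ w)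
    in as , inA , degree-bound-≤ (p₂ * w) m 1 p₁ (2 * p₁) deg degree (N₃ p₁ p₂ w) (v₃ p₁ p₂ w))
  where
  w : ℕ
  w = product ps
  1≤w : 1 ≤ w
  1≤w = ℕ.>-nonZero⁻¹ w ⦃ product≢0 (All.map prime⇒nonZero ps-prime) ⦄
  1≤p₂ : 1 ≤ p₂
  1≤p₂ = ℕ.>-nonZero⁻¹ p₂ ⦃ prime⇒nonZero p₂-prime ⦄
  p₁≡ : p₁ ≡ 1 + 2 * suc _
  p₁≡ = proj₂ (odd-prime p₁-prime p₁-odd)
  p₂≡ : p₂ ≡ 1 + 2 * suc _
  p₂≡ = proj₂ (odd-prime p₂-prime p₂-odd)
  n₁ : ∀ p q w → 2 * (p * (q * w)) ≡ w * (p * q) * 2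
  n₁ = solve-∀
  n₃ : ∀ p q w → 2 * (p * (q * w)) ≡ q * w * p * 2
  n₃ = solve-∀
  v₁ : ∀ p q w → 2 * (p * (q * w)) * (p + q) ≡ w * (q + p) * (2 * p * q)
  v₁ = solve-∀
  v₂ : ∀ p q w → 3 * (2 * (p * (q * w))) ≡ w * (2 * p + p) * (2 * q)
  v₂ = solve-∀
  v₃ : ∀ p q w → 2 * (p * (q * w)) ≡ q * w * 1 * (2 * p)
  v₃ = solve-∀
  N₁ : ∀ p q w → 2 * (p * (q * w)) ≡ w * (2 * (p * q))
  N₁ = solve-∀
  N₃ : ∀ p q w → 2 * (p * (q * w)) ≡ q * w * (2 * p)
  N₃ = solve-∀
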